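{- For every integer $k\geq 3$ there exist a constant $b_k>0$ and an integer $n_0=n_0(k)$ such that for every $n\geq n_0$ there exists $I\in[n]^{(k-1)}$ with $1\in I$ such that for every ordered $k$-graph $(F,<)\in\mathcal{F}^{*}_I(n,k)$ there is a coloring of $[t_{k-1}(n^{b_k})]^{(k)}$ with $4$ colors containing no monochromatic copy of $(F,<)$.
   Context: $X^{(k)}$ denotes the set of $k$-element subsets of $X$, and $[M]=\{1,\dots,M\}$. The tower function is $t_0(x)=x$, $t_{i+1}(x)=2^{t_i(x)}$. An ordered $k$-graph $(F,<)$ is a $k$-uniform hypergraph together with a linear order on its vertex set; ordered $k$-graphs are considered up to order-preserving isomorphism. A coloring $\chi$ of $[M]^{(k)}$ contains a monochromatic copy of $(F,<)$ (in color $\alpha$) if there is an order-preserving injection $\varphi:V(F)\to[M]$ (with the natural order on $[M]$) such that $\chi(\varphi(e))=\alpha$ for every edge $e$ of $F$. For integers $k,n\geq 3$ and $I\in[n]^{(k-1)}$ with $1\in I$, $\mathcal{F}_I^{(k)}(n)$ is the family of ordered $k$-graphs $(F,<)$ such that: $V(F)=\{x_0,\dots,x_n\}\cup\{x_J: J\in\{2,\dots,n\}^{(k-1)}\cup\{I\}\}$, where $x_0<x_1<\dots<x_n$ are distinct, $x_I=x_0$, and for every $J\in\{2,\dots,n\}^{(k-1)}$ we have $x_0\leq x_J\leq x_1$ (distinct $J$ may give the same vertex $x_J$, and $x_J$ may equal $x_0$ or $x_1$); the edge set is $\{\{x_J\}\cup\{x_j:j\in J\}: J\in\{2,\dots,n\}^{(k-1)}\cup\{I\}\}$.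 For $(F,<)$ let $<_{\mathrm{rev}}$ be the reverse order ($x<_{\mathrm{rev}}y$ iff $y<x$), and $\mathrm{rev}\,\mathcal{F}_I^{(k)}(n)=\{(F,<_{\mathrm{rev}}):(F,<)\in\mathcal{F}_I^{(k)}(n)\}$. Finally $\mathcal{F}^{*}_I(n,k)$ is the family of ordered $k$-graphs that contain an ordered subhypergraph isomorphic to a member of $\mathcal{F}_I^{(k)}(n)$ and an ordered subhypergraph isomorphic to a member of $\mathrm{rev}\,\mathcal{F}_I^{(k)}(n)$. -}

module Defs where

open import Level using (0ℓ)
open import Data.Nat using (ℕ; zero; suc; _^_; _≤_; _<_)
open import Data.Fin using (Fin; toℕ; opposite) renaming (zero to fzero; suc to fsuc)
import Data.Fin as F
open import Data.Product using (Σ; ∃; _×_; _,_)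
open import Data.Sum using (_⊎_)
open import Relation.Binary.PropositionalEquality using (_≡_)
open import Relation.Nullary using (¬_)

t : ℕ → ℕ → ℕ
t zero    x = x
t (suc i) x = 2 ^ t i x

Increasing : {a b : ℕ} → (Fin a → Fin b) → Set
Increasing f = ∀ i j → i F.< j → f i F.< f j

-- A k-subset of [b] (b = {0,..,b-1} as Fin b) is represented by its
-- increasing enumeration  Fin k → Fin b.

-- An ordered k-graph: vertex set Fin V with its natural order, and an
-- edge predicate on k-tuples; only increasing tuples (= k-sets) matter.
record OrdGraph (k : ℕ) : Set₁ where
  field
    V    : ℕ
    Edge : (Fin k → Fin V) → Set
open OrdGraph public

Contains : {k : ℕ} → OrdGraph k → OrdGraph k → Set
Contains {k} G H =
  Σ (Fin (V H) → Fin (V G)) λ φ → Increasing φ ×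
    ((e : Fin k → Fin (V H)) → Increasing e → Edge H e → Edge G (λ i → φ (e i)))

-- The reversed ordered k-graph (F, <_rev), transported to Fin V with the
-- natural order via v ↦ opposite v.  The increasing enumeration of a set
-- in the reversed order is obtained by reversing the tuple.
rev : {k : ℕ} → OrdGraph k → OrdGraph k
rev {k} G = record
  { V = V G
  ; Edge = λ e → Edge G (λ i → opposite (e (opposite i))) }

-- Colorings of [M]^(k) with c colors (only values on increasing tuples matter).
Coloring : ℕ → ℕ → ℕ → Set
Coloring k M c = (Fin k → Fin M) → Fin c

MonoCopy : {k M c : ℕ} → Coloring k M c → OrdGraph k → Set
MonoCopy {k} {M} {c} χ G =
  Σ (Fin (V G) → Fin M) λ φ → Increasing φ × Σ (Fin c) λ α →
    ((e : Fin k → Fin (V G)) → Increasing e → Edge G e → χ (λ i → φ (e i)) ≡ α)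

-- Indices: [n] = {1..n} is represented inside Fin (suc n) = {0..n}.
-- J ∈ {2,..,n}^(k1): increasing J : Fin k1 → Fin (suc n) with all values ≥ 2.
IsJ : (k1 n : ℕ) → (Fin k1 → Fin (suc n)) → Set
IsJ k1 n J = Increasing J × (∀ i → 2 ≤ toℕ (J i))

IsI : (k1 n : ℕ) → (Fin k1 → Fin (suc n)) → Set
IsI k1 n I = Increasing I × (∀ i → 1 ≤ toℕ (I i)) × Σ (Fin k1) λ i → toℕ (I i) ≡ 1

-- Membership of (F,<) in  F_I^{(k)}(n),  k = suc k1.
-- x i is the vertex x_i (i = 0..n), y J the vertex x_J; x_I = x_0.
-- The edge {x_J} ∪ {x_j : j ∈ J} has increasing enumeration
-- (x_J, x_{J 0}, ..., x_{J (k1-1)}) since x_J ≤ x_1 < x_j for j ≥ 2,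
-- resp. x_0 < x_j for j ∈ I.
InFam : (k1 n : ℕ) → (Fin k1 → Fin (suc n)) → OrdGraph (suc k1) → Set
InFam k1 n I G =
  Σ (Fin (suc n) → Fin (V G)) λ x →
  Σ ((Fin k1 → Fin (suc n)) → Fin (V G)) λ y →
    Increasing x
  × (∀ J → IsJ k1 n J → (toℕ (x fzero) ≤ toℕ (y J)) × (∀ i → toℕ i ≡ 1 → toℕ (y J) ≤ toℕ (x i)))
  × (∀ v → (Σ (Fin (suc n)) λ i → x i ≡ v) ⊎ (Σ (Fin k1 → Fin (suc n)) λ J → IsJ k1 n J × y J ≡ v))
  × (∀ (e : Fin (suc k1) → Fin (V G)) → Increasing e →
       Edge G e →
         ((Σ (Fin k1 → Fin (suc n)) λ J → IsJ k1 n J ×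
             (e fzero ≡ y J) × (∀ i → e (fsuc i) ≡ x (J i)))
         ⊎ ((e fzero ≡ x fzero) × (∀ i → e (fsuc i) ≡ x (I i)))))
  × (∀ (e : Fin (suc k1) → Fin (V G)) →
       ((Σ (Fin k1 → Fin (suc n)) λ J → IsJ k1 n J ×
             (e fzero ≡ y J) × (∀ i → e (fsuc i) ≡ x (J i)))
         ⊎ ((e fzero ≡ x fzero) × (∀ i → e (fsuc i) ≡ x (I i)))) →
       Edge G e)

InFStar : (k1 n : ℕ) → (Fin k1 → Fin (suc n)) → OrdGraph (suc k1) → Set₁
InFStar k1 n I G =
    (Σ (OrdGraph (suc k1)) λ F → InFam k1 n I F × Contains G F)
  × (Σ (OrdGraph (suc k1)) λ F → InFam k1 n I F × Contains G (rev F))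

{-# OPTIONS --safe #-}

-- Let δ(x, y) be the highest binary digit in which x and y differ.  A colouring
-- of the k-sets of [N] is stepped up to the (k+1)-sets of [2^N] by looking at the
-- list of gaps δ(x₀,x₁), δ(x₁,x₂), …: a rising list keeps its colour, a falling
-- list gets the colour of its reversal with the two sides exchanged, where two of
-- the four colours are to avoid 𝓕_I and the other two rev 𝓕_I.  Every other list
-- is coloured so that in a 𝓕_I-avoiding colour a list whose first gap is the
-- largest is falling.  If a copy of a member of 𝓕_I has δ(x₀,x₁) < δ(x₁,x_{n+1}),
-- all the x_J may be replaced by x₁ to the right of x_{n+1}, and a ↦ δ(x₁,x_a)
-- either takes many values (a clique one level down) or is constant on a long
-- block (a star, hence a member of rev 𝓕_I, one level down).  If
-- δ(x₀,x₁) > δ(x₁,x_{n+1}), the edge of I = I′ ∪ {n+1} is falling, which forces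
-- all the edges with body in [2, n+1] to be falling, and the gaps δ(x_j,x_{j+1})
-- form a member of rev 𝓕_{I′} one level down.  Cliques of pairs are excluded by
-- Erdős's counting bound, and each step only squares n.

module Submission where

open import Defs
open import Data.Bool using (Bool; true; false; not; if_then_else_; _∧_; _∨_; _xor_)
open import Data.Bool.Properties using (not-¬)
open import Data.Empty using (⊥)
open import Data.Fin using (Fin; toℕ; fromℕ; fromℕ<; inject₁; opposite) renaming (zero to fzero; suc to fsuc)
import Data.Fin as F
import Data.Fin.Properties as Fₚ
open import Data.List using (List; []; _∷_; _++_; [_]; map; length; reverse; _ʳ++_; tabulate; downFrom)
open import Data.List.Membership.Propositional using (_∈_)
open import Data.List.Membership.Propositional.Properties using (∈-map⁺; ∈-map⁻; ∈-++⁺ˡ; ∈-++⁺ʳ; ∈-++⁻; ∈-downFrom⁻)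
open import Data.List.Properties using (map-∘; length-map; length-++; length-reverse; length-downFrom; reverse-involutive; reverse-++; map-tabulate; tabulate-cong; ∷-injectiveˡ)
open import Data.List.Relation.Unary.All as All using (All; []; _∷_)
import Data.List.Relation.Unary.All.Properties as Allₚ
open import Data.List.Relation.Unary.AllPairs using ([]; _∷_)
open import Data.List.Relation.Unary.Any using (here; there)
open import Data.List.Relation.Unary.Linked as Linked using (Linked; []; [-]; _∷_)
open import Data.List.Relation.Unary.Unique.Propositional using (Unique)
import Data.List.Relation.Unary.Unique.Propositional.Properties as Uniqueₚ
open import Data.Nat
open import Data.Nat.Properties
open import Data.Nat.Solver using (module +-*-Solver)
open import Data.Product using (Σ; ∃; _×_; _,_; proj₁; proj₂)
open import Data.Product.Properties using (≡-dec; ,-injectiveʳ)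
open import Data.Sum using (_⊎_; inj₁; inj₂)
open import Data.Unit using (⊤; tt)
open import Function using (_∘_; flip)
open import Relation.Binary.Definitions using (DecidableEquality; Transitive; tri<; tri≈; tri>)
open import Relation.Binary.PropositionalEquality using (_≡_; _≢_; refl; sym; trans; cong; cong₂; subst; subst₂; module ≡-Reasoning)
open import Relation.Nullary using (¬_; Dec; yes; no; does; contradiction)
open import Relation.Nullary.Decidable using (dec-true; dec-false)

-- Copies along an order, and gap lists

-- Index sets as increasing lists; with the lower bound as an argument that moves along, order and
-- range are handled in one induction.
data Ix (lo hi : ℕ) : List ℕ → Set where
  []   : Ix lo hi []
  cons : ∀ {j J} → lo ≤ j → j ≤ hi → Ix (suc j) hi J → Ix lo hi (j ∷ J)

Ix-weaken : ∀ {lo lo′ hi hi′ J} → lo′ ≤ lo → hi ≤ hi′ → Ix lo hi J → Ix lo′ hi′ J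
Ix-weaken p q []           = []
Ix-weaken p q (cons a b J) = cons (≤-trans p a) (≤-trans b q) (Ix-weaken ≤-refl q J)

Ix-snoc : ∀ {lo hi h J} → hi < h → lo ≤ h → Ix lo hi J → Ix lo h (J ++ [ h ])
Ix-snoc p q []           = cons q ≤-refl []
Ix-snoc p q (cons a b J) = cons a (≤-trans b (<⇒≤ p)) (Ix-snoc p (≤-<-trans b p) J)

Ix-map : ∀ {f : ℕ → ℕ} → (∀ {i j} → i < j → f i < f j) →
         ∀ {lo hi J} → Ix lo hi J → Ix (f lo) (f hi) (map f J)
Ix-map {f} f-< = go
  where
  f-≤ : ∀ {i j} → i ≤ j → f i ≤ f j
  f-≤ i≤j with m≤n⇒m<n∨m≡n i≤j
  ... | inj₁ i<j  = <⇒≤ (f-< i<j)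
  ... | inj₂ refl = ≤-refl
  go : ∀ {lo hi J} → Ix lo hi J → Ix (f lo) (f hi) (map f J)
  go []           = []
  go (cons a b J) = cons (f-≤ a) (f-≤ b) (Ix-weaken (f-< (n<1+n _)) ≤-refl (go J))

interval : ℕ → ℕ → List ℕ
interval c zero    = []
interval c (suc k) = c ∷ interval (suc c) k

length-interval : ∀ c k → length (interval c k) ≡ k
length-interval c zero    = refl
length-interval c (suc k) = cong suc (length-interval (suc c) k)

Ix-interval : ∀ c k {h} → c + k ≤ suc h → Ix c h (interval c k)
Ix-interval c zero    _ = []
Ix-interval c (suc k) {h} p =
  cons ≤-refl (≤-pred (≤-trans (m≤m+n (suc c) k) q)) (Ix-interval (suc c) k q)
  where
  q : suc c + k ≤ suc h
  q = subst (_≤ suc h) (+-suc c k) p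

linked-interval : ∀ {f : ℕ → ℕ} c l {j} → Linked _>_ (map f (interval c l)) →
                  c ≤ j → suc j < c + l → f (suc j) < f j
linked-interval c zero {j} _ c≤j p =
  contradiction (≤-trans (<⇒≤ p) (≤-trans (≤-reflexive (+-identityʳ c)) c≤j)) (<⇒≱ ≤-refl)
linked-interval c (suc zero) {j} _ c≤j p =
  contradiction (≤-trans p (≤-trans (≤-reflexive (+-comm c 1)) (s≤s c≤j))) (<⇒≱ ≤-refl)
linked-interval c (suc (suc l)) {j} (q ∷ qs) c≤j p with m≤n⇒m<n∨m≡n c≤j
... | inj₂ refl = q
... | inj₁ c<j  = linked-interval (suc c) (suc l) qs c<j (subst (suc j <_) (+-suc c (suc l)) p)

stepwise⇒ : ∀ {_~_ : ℕ → ℕ → Set} → Transitive _~_ → ∀ (f : ℕ → ℕ) {lo n} →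
            (∀ j → lo ≤ j → suc j ≤ n → f j ~ f (suc j)) →
            ∀ {i j} → lo ≤ i → i < j → j ≤ n → f i ~ f j
stepwise⇒ {_~_} tr f {lo} {n} step = go
  where
  go : ∀ {i j} → lo ≤ i → i < j → j ≤ n → f i ~ f j
  go {i} {suc j} lo≤i i<j j≤n with m≤n⇒m<n∨m≡n (≤-pred i<j)
  ... | inj₂ refl = step i lo≤i j≤n
  ... | inj₁ i<j′ = tr (go lo≤i i<j′ (<⇒≤ j≤n)) (step j (≤-trans lo≤i (<⇒≤ i<j′)) j≤n)

-- Copies in a family of lists over an arbitrary order; an edge is listed
-- upwards for the order at hand, so reversed copies are copies for flip _≺_.
record Copy (_≺_ : ℕ → ℕ → Set) (E : List ℕ → Set) (k n : ℕ) (I : List ℕ) : Set where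
  field
    x    : ℕ → ℕ
    x-≺  : ∀ {i j} → i < j → j ≤ n → x i ≺ x j
    edge : ∀ J → Ix 2 n J → length J ≡ k →
           ∃ λ y → (x 0 ≡ y ⊎ x 0 ≺ y) × (y ≡ x 1 ⊎ y ≺ x 1) × E (y ∷ map x J)
    base : E (x 0 ∷ map x I)

record Clique (_≺_ : ℕ → ℕ → Set) (E : List ℕ → Set) (k r : ℕ) : Set where
  field
    x    : ℕ → ℕ
    x-≺  : ∀ {i j} → i < j → j ≤ r → x i ≺ x j
    edge : ∀ J → Ix 0 r J → length J ≡ k → E (map x J)

-- Taking every x_J to be `x 0` makes all required edges edges of the clique. So excluding copies at
-- one stage also bounds its cliques.
clique⇒copy : ∀ {_≺_ E k n I} → 1 ≤ n → Ix 1 n I → length I ≡ k →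
              Clique _≺_ E (suc k) n → Copy _≺_ E k n I
clique⇒copy {I = I} 1≤n I-ix I-len c = record
  { x    = x
  ; x-≺  = x-≺
  ; edge = λ J J-ix J-len → x 0 , inj₁ refl , inj₂ (x-≺ (n<1+n 0) 1≤n) ,
             edge (0 ∷ J) (cons z≤n z≤n (Ix-weaken (n≤1+n 1) ≤-refl J-ix)) (cong suc J-len)
  ; base = edge (0 ∷ I) (cons z≤n z≤n I-ix) (cong suc I-len)
  }
  where open Clique c

-- Gap functions and the gaps of a sequence

gaps : (ℕ → ℕ → ℕ) → ℕ → List ℕ → List ℕ
gaps δ u []      = []
gaps δ u (a ∷ l) = δ u a ∷ gaps δ a l

HeadMax : List ℕ → Set
HeadMax []       = ⊤
HeadMax (d ∷ ds) = All (_< d) ds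

-- Building the bound `N` into the order spares `Copy` and `Clique` a ground set, and the bound
-- survives flipping the order.
_<[_]_ : ℕ → ℕ → ℕ → Set
a <[ N ] b = a < b × b < N

-- The properties of δ that the argument uses, stated for any order so that `_<[_]_` and its flip
-- are treated at once.
record GapFunction (_≺_ : ℕ → ℕ → Set) (δ : ℕ → ℕ → ℕ) (N : ℕ) : Set where
  field
    δ-max   : ∀ {x y z} → x ≺ y → y ≺ z → δ x z ≡ δ x y ⊔ δ y z
    δ-≢     : ∀ {x y z} → x ≺ y → y ≺ z → δ x y ≢ δ y z
    δ-bound : ∀ {x y} → x ≺ y → δ x y < N

⊔-right : ∀ {a b m} → m ≡ a ⊔ b → a < m → b ≡ m
⊔-right {a} {b} refl a<m with ⊔-sel a b
... | inj₁ e = contradiction (subst (a <_) e a<m) (<-irrefl refl)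
... | inj₂ e = sym e

All-linked : ∀ {d ds} → Linked _>_ (d ∷ ds) → All (_< d) ds
All-linked [-]      = []
All-linked (p ∷ ps) = p ∷ All.map (λ q → <-trans q p) (All-linked ps)

linked-map : ∀ {f : ℕ → ℕ} {lo n} → (∀ {i j} → lo ≤ i → i < j → j ≤ n → f j < f i) →
             ∀ {i J} → lo ≤ i → Ix (suc i) n J → Linked _>_ (map f (i ∷ J))
linked-map f-> lo≤i []           = [-]
linked-map f-> lo≤i (cons p q J) = f-> lo≤i p q ∷ linked-map f-> (≤-trans lo≤i (<⇒≤ p)) J

module _ {_≺_ : ℕ → ℕ → Set} {δ : ℕ → ℕ → ℕ} {N : ℕ} (gapF : GapFunction _≺_ δ N) where

  open GapFunction gapF

  module Sequence (w : ℕ → ℕ) (h : ℕ) (w-≺ : ∀ {i j} → i < j → j ≤ h → w i ≺ w j) where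

    δ-left : ∀ {a a′ b} → a ≤ a′ → a′ < b → b ≤ h → δ (w a′) (w b) ≤ δ (w a) (w b)
    δ-left {a} {a′} {b} a≤a′ a′<b b≤h with m≤n⇒m<n∨m≡n a≤a′
    ... | inj₂ refl = ≤-refl
    ... | inj₁ a<a′ = subst (δ (w a′) (w b) ≤_) (sym (δ-max (w-≺ a<a′ (≤-trans (<⇒≤ a′<b) b≤h)) (w-≺ a′<b b≤h)))
                        (m≤n⊔m _ _)

    δ-right : ∀ {a b b′} → a < b → b ≤ b′ → b′ ≤ h → δ (w a) (w b) ≤ δ (w a) (w b′)
    δ-right {a} {b} {b′} a<b b≤b′ b′≤h with m≤n⇒m<n∨m≡n b≤b′
    ... | inj₂ refl = ≤-refl
    ... | inj₁ b<b′ = subst (δ (w a) (w b) ≤_) (sym (δ-max (w-≺ a<b (≤-trans b≤b′ b′≤h)) (w-≺ b<b′ b′≤h)))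
                        (m≤m⊔n _ _)

    δ-mono : ∀ {a a′ b b′} → a ≤ a′ → a′ < b → b ≤ b′ → b′ ≤ h → δ (w a′) (w b) ≤ δ (w a) (w b′)
    δ-mono p q r s = ≤-trans (δ-left p q (≤-trans r s)) (δ-right (≤-<-trans p q) r s)

    gaps-≤ : ∀ {lo hi a J} → hi ≤ h → lo ≤ a → Ix (suc a) hi J →
             All (_≤ δ (w lo) (w hi)) (gaps δ (w a) (map w J))
    gaps-≤ hi≤h p []           = []
    gaps-≤ hi≤h p (cons q r J) = δ-mono p q r hi≤h ∷ gaps-≤ hi≤h (≤-trans p (<⇒≤ q)) J

    -- By `δ-max`, the gap from `a` to `hi` is the maximum of the gaps along the chain between them.
    gaps-< : ∀ {a hi d J} → hi ≤ h → a < hi → Ix (suc a) hi (J ++ [ hi ]) →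
             All (_< d) (gaps δ (w a) (map w (J ++ [ hi ]))) → δ (w a) (w hi) < d
    gaps-< {J = []}    hi≤h p _            (q ∷ []) = q
    gaps-< {a} {hi} {d} {j ∷ J} hi≤h p (cons a<j j≤hi J-ix) (q ∷ qs) =
      subst (_< d) (sym (δ-max (w-≺ a<j (≤-trans j≤hi hi≤h)) (w-≺ j<hi hi≤h)))
        (⊔-lub q (gaps-< hi≤h j<hi J-ix qs))
      where
      snoc-< : ∀ {j} J → Ix (suc j) hi (J ++ [ hi ]) → j < hi
      snoc-< []      (cons p _ _) = p
      snoc-< (_ ∷ _) (cons p q _) = ≤-trans p q
      j<hi : j < hi
      j<hi = snoc-< J J-ix

    y : ℕ → ℕ
    y j = δ (w j) (w (suc j))

    module _ {lo n} (n<h : n < h) (y-> : ∀ {i j} → lo ≤ i → i < j → j ≤ n → y j < y i) where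

      -- The gap across a stretch is the maximum of its consecutive gaps, and when these fall it is
      -- the first of them.
      δ-falling : ∀ {i j} → lo ≤ i → i < j → j ≤ suc n → δ (w i) (w j) ≡ y i
      δ-falling {i} {suc j} lo≤i i<j j≤n with m≤n⇒m<n∨m≡n (≤-pred i<j)
      ... | inj₂ refl = refl
      ... | inj₁ i<j′ = begin
        δ (w i) (w (suc j))   ≡⟨ δ-max (w-≺ i<j′ (≤-trans (≤-pred j≤n) (<⇒≤ n<h))) (w-≺ ≤-refl (≤-trans j≤n n<h)) ⟩
        δ (w i) (w j) ⊔ y j   ≡⟨ cong (_⊔ y j) (δ-falling lo≤i i<j′ (<⇒≤ j≤n)) ⟩
        y i ⊔ y j             ≡⟨ m≥n⇒m⊔n≡m (<⇒≤ (y-> lo≤i i<j′ (≤-pred j≤n))) ⟩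
        y i                   ∎
        where open ≡-Reasoning

      -- Each gap depends only on its left end, so the closing point `suc n` turns the gaps into
      -- values of `y` at the other indices. This is why every step appends a new largest element to
      -- the index set.
      gaps-falling : ∀ {i J} → lo ≤ i → i ≤ n → Ix (suc i) n J →
                     gaps δ (w i) (map w (J ++ [ suc n ])) ≡ map y (i ∷ J)
      gaps-falling lo≤i i≤n []           = cong (_∷ []) (δ-falling lo≤i (s≤s i≤n) ≤-refl)
      gaps-falling lo≤i i≤n (cons p q J) =
        cong₂ _∷_ (δ-falling lo≤i p (m≤n⇒m≤1+n q)) (gaps-falling (≤-trans lo≤i (<⇒≤ p)) q J)

    gaps-interval : ∀ c k → gaps δ (w c) (map w (interval (suc c) k)) ≡ map y (interval c k)
    gaps-interval c zero    = refl
    gaps-interval c (suc k) = cong (y c ∷_) (gaps-interval (suc c) k)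

  -- One step down, from bodies of size k + 2 to bodies of size k + 1

  module Step
    {E C R : List ℕ → Set} {k r n : ℕ} {I : List ℕ}
    -- `E` is a colour class; `C` and `R` are the classes one level down into which its rising and
    -- its falling gap lists pass.
    (E⇒C : ∀ {u l} → length l ≡ suc (suc k) → E (u ∷ l) → Linked _<_ (gaps δ u l) → C (gaps δ u l))
    (E⇒R : ∀ {u l} → length l ≡ suc (suc k) → E (u ∷ l) → Linked _>_ (gaps δ u l) → R (gaps δ u l))
    (falling : ∀ {u l} → length l ≡ suc (suc k) → E (u ∷ l) → HeadMax (gaps δ u l) → Linked _>_ (gaps δ u l))
    (no-clique : ¬ Clique _<[ N ]_ C (suc (suc k)) r)
    (no-copy : ¬ Copy (flip _<[ N ]_) R (suc k) n (1 ∷ I))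
    (1≤n : 1 ≤ n) (I-ix : Ix 2 n I) (I-len : length I ≡ k)
    -- n = 1 occurs only in the step from pairs to triples.
    (I-head : (n ≡ 1 × I ≡ []) ⊎ (suc (suc k) ≤ n × ∃ λ I′ → I ≡ 2 ∷ I′))
    where

    length-snoc : ∀ (l : List ℕ) {m a} → length l ≡ m → length (l ++ [ a ]) ≡ suc m
    length-snoc l {m} p = trans (length-++ l) (trans (cong (_+ 1) p) (+-comm m 1))

    -- The gaps `y` are the vertices of a copy for the flipped order. The edge with body `J` comes
    -- from the edge with body `J ++ [ suc n ]`, whose first gap serves as x_J.
    falling⇒⊥ :
      (w : ℕ → ℕ) (w-≺ : ∀ {i j} → i < j → j ≤ suc n → w i ≺ w j) →
      let open Sequence w (suc n) w-≺ in
      (∀ {i j} → 0 ≤ i → i < j → j ≤ n → y j < y i) →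
      (∃ λ u → E (u ∷ map w (1 ∷ I ++ [ suc n ])) × δ u (w 1) ≡ y 0) →
      (∀ J → Ix 2 (suc n) J → length J ≡ suc (suc k) →
         ∃ λ u → E (u ∷ map w J) × (∀ a → 2 ≤ a → a ≤ suc n → y 1 ≤ δ u (w a) × δ u (w a) ≤ y 0)) →
      ⊥
    falling⇒⊥ w w-≺ y-> (u₀ , e₀ , δu₀) edges = no-copy (record
      { x    = y
      ; x-≺  = λ i<j j≤n → y-> z≤n i<j j≤n , y-bound (≤-trans (<⇒≤ i<j) j≤n)
      ; edge = edge
      ; base = subst R base-gaps (E⇒R (trans (length-map w (1 ∷ I ++ [ suc n ])) (cong suc (length-snoc I I-len))) e₀ (subst (Linked _>_) (sym base-gaps) base-linked))
      })
      where
      open Sequence w (suc n) w-≺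
      y-bound : ∀ {i} → i ≤ n → y i < N
      y-bound i≤n = δ-bound (w-≺ ≤-refl (s≤s i≤n))
      base-gaps : gaps δ u₀ (map w (1 ∷ I ++ [ suc n ])) ≡ map y (0 ∷ 1 ∷ I)
      base-gaps = cong₂ _∷_ δu₀ (gaps-falling ≤-refl y-> z≤n 1≤n I-ix)
      base-linked : Linked _>_ (map y (0 ∷ 1 ∷ I))
      base-linked = linked-map y-> z≤n (cons ≤-refl 1≤n I-ix)
      edge : ∀ J → Ix 2 n J → length J ≡ suc k →
             ∃ λ z → (y 0 ≡ z ⊎ flip _<[ N ]_ (y 0) z) × (z ≡ y 1 ⊎ flip _<[ N ]_ z (y 1)) × R (z ∷ map y J)
      edge (a ∷ J) ixs@(cons 2≤a a≤n J-ix) J-len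
        with edges (a ∷ J ++ [ suc n ]) (Ix-snoc ≤-refl (s≤s 1≤n) ixs) (length-snoc (a ∷ J) J-len)
      ... | u , e , bounds =
        δ u (w a) , top , bottom ,
        subst R eq (E⇒R (length-map-snoc) e (subst (Linked _>_) (sym eq) linked))
        where
        lower = proj₁ (bounds a 2≤a (m≤n⇒m≤1+n a≤n))
        upper = proj₂ (bounds a 2≤a (m≤n⇒m≤1+n a≤n))
        length-map-snoc : length (map w (a ∷ J ++ [ suc n ])) ≡ suc (suc k)
        length-map-snoc = trans (length-map w (a ∷ J ++ [ suc n ])) (length-snoc (a ∷ J) J-len)
        eq : gaps δ u (map w (a ∷ J ++ [ suc n ])) ≡ δ u (w a) ∷ map y (a ∷ J)
        eq = cong (δ u (w a) ∷_) (gaps-falling ≤-refl y-> z≤n a≤n J-ix)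
        linked : Linked _>_ (δ u (w a) ∷ map y (a ∷ J))
        linked = <-≤-trans (y-> z≤n 2≤a a≤n) lower ∷ linked-map y-> z≤n J-ix
        top : y 0 ≡ δ u (w a) ⊎ flip _<[ N ]_ (y 0) (δ u (w a))
        top with m≤n⇒m<n∨m≡n upper
        ... | inj₁ p = inj₂ (p , y-bound z≤n)
        ... | inj₂ p = inj₁ (sym p)
        bottom : δ u (w a) ≡ y 1 ⊎ flip _<[ N ]_ (δ u (w a)) (y 1)
        bottom with m≤n⇒m<n∨m≡n lower
        ... | inj₁ p = inj₂ (p , ≤-<-trans upper (y-bound z≤n))
        ... | inj₂ p = inj₁ (sym p)

    -- A body of `k + 2` consecutive points gives an edge whose first gap is the largest, hence a
    -- falling one; its other gaps are consecutive values of `y`.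
    interval-falling :
      ∀ {h lo} (w : ℕ → ℕ) (w-≺ : ∀ {i j} → i < j → j ≤ h → w i ≺ w j) →
      let open Sequence w h w-≺ in
      (∀ J → Ix lo h J → length J ≡ suc (suc k) →
         ∃ λ u → E (u ∷ map w J) × (∀ a → lo ≤ a → a ≤ h → δ (w lo) (w h) < δ u (w a))) →
      1 ≤ k → lo + suc (suc k) ≤ suc h →
      ∀ j → lo ≤ j → suc (suc j) ≤ h → y (suc j) < y j
    interval-falling {h} {lo} w w-≺ edges 1≤k fits j lo≤j j+2≤h = go (j + suc (suc k) ≤? suc h)
      where
      open Sequence w h w-≺
      from : ∀ c → lo ≤ c → c ≤ j → c + suc (suc k) ≤ suc h → suc j < c + suc k → y (suc j) < y j
      from c lo≤c c≤j c-fits j< = linked-interval c (suc k) (subst (Linked _>_) (gaps-interval c (suc k)) (Linked.tail linked)) c≤j j<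
        where
        J-ix : Ix c h (interval c (suc (suc k)))
        J-ix = Ix-interval c (suc (suc k)) c-fits
        c≤h : c ≤ h
        c≤h = ≤-trans c≤j (≤-trans (m≤n+m j 2) j+2≤h)
        e = edges _ (Ix-weaken lo≤c ≤-refl J-ix) (length-interval c (suc (suc k)))
        tail-ix : Ix (suc c) h (interval (suc c) (suc k))
        tail-ix = Ix-interval (suc c) (suc k) (subst (_≤ suc h) (+-suc c (suc k)) c-fits)
        linked : Linked _>_ (gaps δ (proj₁ e) (map w (interval c (suc (suc k)))))
        linked = falling (trans (length-map w (interval c (suc (suc k)))) (length-interval c (suc (suc k)))) (proj₁ (proj₂ e))
          (All.map (λ p → ≤-<-trans p (proj₂ (proj₂ e) c lo≤c c≤h)) (gaps-≤ ≤-refl lo≤c tail-ix))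
      go : _ → y (suc j) < y j
      -- The interval starting at `j` covers both gaps because `1 ≤ k`; if it does not fit, the last
      -- interval that fits is used.
      go (yes p) = from j lo≤j ≤-refl p (subst (suc j <_) (sym (+-suc j k)) (s≤s (m<m+n j 1≤k)))
      go (no p)  = from c lo≤c c≤j (≤-reflexive c+k+2) (≤-pred (subst (suc (suc (suc j)) ≤_) (trans (sym c+k+2) (+-suc c (suc k))) (s≤s j+2≤h)))
        where
        k+2≤ : suc (suc k) ≤ suc h
        k+2≤ = ≤-trans (m≤n+m _ lo) fits
        c = suc h ∸ suc (suc k)
        c+k+2 : c + suc (suc k) ≡ suc h
        c+k+2 = m∸n+n≡m k+2≤
        lo≤c : lo ≤ c
        lo≤c = m+n≤o⇒m≤o∸n lo fits
        c≤j : c ≤ j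
        c≤j = ≤-trans (∸-monoˡ-≤ (suc (suc k)) (<⇒≤ (≰⇒> p))) (≤-reflexive (m+n∸n≡m j (suc (suc k))))

    copy⇒⊥ : ∀ {n′} → suc n + r * n ≤ n′ → ¬ Copy _≺_ E (suc (suc k)) n′ (1 ∷ I ++ [ suc n ])
    copy⇒⊥ {n′} n′-big copy = cases (<-cmp (δ (x 0) (x 1)) (D (suc n)))
      where
      open Copy copy
      open Sequence x n′ x-≺
      D : ℕ → ℕ
      D a = δ (x 1) (x a)
      n<n′ : suc n ≤ n′
      n<n′ = ≤-trans (m≤m+n (suc n) (r * n)) n′-big
      1<n′ : 1 < n′
      1<n′ = ≤-trans (s≤s 1≤n) n<n′
      x₀≺x₁ : x 0 ≺ x 1
      x₀≺x₁ = x-≺ ≤-refl (<⇒≤ 1<n′)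
      I′-ix : Ix 2 (suc n) (I ++ [ suc n ])
      I′-ix = Ix-snoc ≤-refl (s≤s 1≤n) I-ix

      -- All the vertices between x 0 and x 1 have the same gaps to x a, a > n,
      -- as x 1, so the copy contains a star centred at x 1.
      module Rising (δ₀<D : δ (x 0) (x 1) < D (suc n)) where

        to-x₁ : ∀ {u} → (x 0 ≡ u ⊎ x 0 ≺ u) → (u ≡ x 1 ⊎ u ≺ x 1) →
                ∀ a → suc n ≤ a → a ≤ n′ → δ u (x a) ≡ D a
        to-x₁ _ (inj₁ refl) a _ _ = refl
        to-x₁ {u} x₀≼u (inj₂ u≺x₁) a n<a a≤n′ = begin
          δ u (x a)             ≡⟨ δ-max u≺x₁ (x-≺ (≤-trans (s≤s 1≤n) n<a) a≤n′) ⟩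
          δ u (x 1) ⊔ D a       ≡⟨ m≤n⇒m⊔n≡n (≤-trans (δu≤ x₀≼u) (≤-trans (<⇒≤ δ₀<D) (δ-right (s≤s 1≤n) n<a a≤n′))) ⟩
          D a                   ∎
          where
          open ≡-Reasoning
          δu≤ : (x 0 ≡ u ⊎ x 0 ≺ u) → δ u (x 1) ≤ δ (x 0) (x 1)
          δu≤ (inj₁ refl) = ≤-refl
          δu≤ (inj₂ x₀≺u) = subst (δ u (x 1) ≤_) (sym (δ-max x₀≺u u≺x₁)) (m≤n⊔m _ _)

        star : ∀ J → Ix (suc n) n′ J → length J ≡ suc (suc k) →
               ∃ λ u → E (u ∷ map x J) × (∀ a → suc n ≤ a → a ≤ n′ → δ u (x a) ≡ D a)
        star J J-ix J-len with edge J (Ix-weaken (s≤s 1≤n) ≤-refl J-ix) J-len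
        ... | u , x₀≼u , u≼x₁ , e = u , e , to-x₁ x₀≼u u≼x₁

        -- End points of `r` blocks of length `n` beyond `suc n`. As `D` is nondecreasing, it either
        -- grows across every block or is constant on one.
        p : ℕ → ℕ
        p i = suc n + i * n
        p-< : ∀ {i j} → i < j → p i < p j
        p-< i<j = +-monoʳ-< (suc n) (*-monoˡ-< n {{>-nonZero 1≤n}} i<j)
        p-≤ : ∀ {i j} → i ≤ j → p i ≤ p j
        p-≤ i≤j = +-monoʳ-≤ (suc n) (*-monoˡ-≤ n i≤j)
        p≥ : ∀ i → suc n ≤ p i
        p≥ i = m≤m+n (suc n) (i * n)
        p≤ : ∀ {i} → i ≤ r → p i ≤ n′
        p≤ i≤r = ≤-trans (p-≤ i≤r) n′-big
        1<p : ∀ i → 1 < p i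
        1<p i = ≤-trans (s≤s 1≤n) (p≥ i)

        module Distinct (D-≢ : ∀ i → i < r → D (p i) ≢ D (p (suc i))) where

          q : ℕ → ℕ
          q i = D (p i)
          q-< : ∀ {i j} → i < j → j ≤ r → q i < q j
          q-< = stepwise⇒ {_<_} <-trans q
            (λ j _ j<r → ≤∧≢⇒< (δ-right (1<p j) (p-≤ (n≤1+n j)) (p≤ j<r)) (D-≢ j j<r)) z≤n
          gaps-q : ∀ {i J} → Ix (suc i) r J → gaps δ (x (p i)) (map x (map p J)) ≡ map q J
          gaps-q [] = refl
          gaps-q {i} (cons {j} i<j j≤r J-ix) = cong₂ _∷_
            -- `q j` is the maximum of `q i` and the gap from `p i` to `p j`, and it exceeds `q i`.
            (⊔-right (δ-max (x-≺ (1<p i) (p≤ (≤-trans (<⇒≤ i<j) j≤r))) (x-≺ (p-< i<j) (p≤ j≤r))) (q-< i<j j≤r))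
            (gaps-q J-ix)
          linked-q : ∀ {i J} → Ix (suc i) r J → Linked _<_ (map q (i ∷ J))
          linked-q []           = [-]
          linked-q (cons a b J) = q-< a b ∷ linked-q J
          clique-edge : ∀ J → Ix 0 r J → length J ≡ suc (suc k) → C (map q J)
          clique-edge (j ∷ J) ixs@(cons _ j≤r J-ix) J-len
            with star (map p (j ∷ J)) (Ix-weaken (p≥ 0) n′-big (Ix-map p-< ixs)) (trans (length-map p (j ∷ J)) J-len)
          ... | u , e , u-D = subst C eq (E⇒C len e (subst (Linked _<_) (sym eq) (linked-q J-ix)))
            where
            len : length (map x (map p (j ∷ J))) ≡ suc (suc k)
            len = trans (length-map x (map p (j ∷ J))) (trans (length-map p (j ∷ J)) J-len)
            eq : gaps δ u (map x (map p (j ∷ J))) ≡ map q (j ∷ J)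
            eq = cong₂ _∷_ (u-D (p j) (p≥ j) (p≤ j≤r)) (gaps-q J-ix)
          absurd : ⊥
          absurd = no-clique (record
            { x    = q
            ; x-≺  = λ {_} {j} i<j j≤r → q-< i<j j≤r , δ-bound (x-≺ (1<p j) (p≤ j≤r))
            ; edge = clique-edge
            })

        module Constant (i : ℕ) (i<r : i < r) (D-≡ : D (p i) ≡ D (p (suc i))) where

          -- The centre x₁, followed by the `n + 1` points from `p i` to `p (suc i)`.
          g : ℕ → ℕ
          g zero    = 1
          g (suc j) = p i + j
          g-< : ∀ {j l} → j < l → g j < g l
          g-< {zero}  {suc l} _   = ≤-trans (1<p i) (m≤m+n (p i) l)
          g-< {suc j} {suc l} j<l = +-monoʳ-< (p i) (≤-pred j<l)
          g-≤ : ∀ {j l} → j ≤ l → g j ≤ g l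
          g-≤ j≤l with m≤n⇒m<n∨m≡n j≤l
          ... | inj₁ j<l  = <⇒≤ (g-< j<l)
          ... | inj₂ refl = ≤-refl
          g-top : g (suc n) ≡ p (suc i)
          g-top = trans (+-assoc (suc n) (i * n) n) (cong (suc n +_) (+-comm (i * n) n))
          g-top≤ : g (suc n) ≤ n′
          g-top≤ = ≤-trans (≤-reflexive g-top) (p≤ i<r)
          g₁ : g 1 ≡ p i
          g₁ = +-identityʳ (p i)
          w : ℕ → ℕ
          w j = x (g j)
          w-≺ : ∀ {j l} → j < l → l ≤ suc n → w j ≺ w l
          w-≺ j<l l≤ = x-≺ (g-< j<l) (≤-trans (g-≤ l≤) g-top≤)
          module W = Sequence w (suc n) w-≺
          D-bottom : D (g 1) ≡ D (p i)
          D-bottom = cong D g₁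
          D-top : D (g (suc n)) ≡ D (p i)
          D-top = trans (cong D g-top) (sym D-≡)
          D-const : ∀ {a} → 1 ≤ a → a ≤ suc n → D (g a) ≡ W.y 0
          D-const {a} 1≤a a≤ = ≤-antisym
            (≤-trans (δ-right (g-< 1≤a) (g-≤ a≤) g-top≤) (≤-reflexive (trans D-top (sym D-bottom))))
            (δ-right (g-< {0} {1} ≤-refl) (g-≤ 1≤a) (≤-trans (g-≤ a≤) g-top≤))
          -- The gap across the block is at most the constant value of `D`, and differs from it as
          -- the two gaps are adjacent.
          block-< : δ (w 1) (w (suc n)) < W.y 0
          block-< = ≤∧≢⇒<
            (subst (δ (w 1) (w (suc n)) ≤_) (D-const (s≤s z≤n) ≤-refl)
              (W.δ-left {0} {1} {suc n} z≤n (s≤s 1≤n) ≤-refl))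
            (λ eq → δ-≢ (w-≺ {0} {1} ≤-refl (s≤s z≤n)) (w-≺ (s≤s 1≤n) ≤-refl) (sym eq))
          edges : ∀ J → Ix 1 (suc n) J → length J ≡ suc (suc k) →
                  ∃ λ u → E (u ∷ map w J) × (∀ a → 1 ≤ a → a ≤ suc n → δ u (w a) ≡ W.y 0)
          edges J J-ix J-len
            with star (map g J) (Ix-weaken (≤-trans (p≥ i) (≤-reflexive (sym g₁))) g-top≤ (Ix-map g-< J-ix)) (trans (length-map g J) J-len)
          ... | u , e , u-D = u , subst (λ l → E (u ∷ l)) (sym (map-∘ J)) e ,
            λ a 1≤a a≤ → trans (u-D (g a) (≤-trans (p≥ i) (≤-trans (≤-reflexive (sym g₁)) (g-≤ 1≤a))) (≤-trans (g-≤ a≤) g-top≤))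
                               (D-const 1≤a a≤)
          y-step : ∀ j → 0 ≤ j → suc j ≤ n → W.y (suc j) < W.y j
          y-step zero    _ j<n = ≤-<-trans (W.δ-right ≤-refl (s≤s j<n) ≤-refl) block-<
          y-step (suc j) _ j<n = higher I-head
            where
            higher : _ → W.y (suc (suc j)) < W.y (suc j)
            higher (inj₁ (refl , _)) = contradiction j<n (λ { (s≤s ()) })
            higher (inj₂ (k+2≤n , I′ , refl)) = interval-falling w w-≺
              (λ J J-ix J-len → let (u , e , u-D) = edges J J-ix J-len in
                 u , e , λ a 1≤a a≤ → subst (δ (w 1) (w (suc n)) <_) (sym (u-D a 1≤a a≤)) block-<)
              (subst (1 ≤_) I-len (s≤s z≤n)) (s≤s (m≤n⇒m≤1+n k+2≤n)) (suc j) (s≤s z≤n) (s≤s j<n)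
          y-> : ∀ {i j} → 0 ≤ i → i < j → j ≤ n → W.y j < W.y i
          y-> = stepwise⇒ {_>_} (λ a b → <-trans b a) W.y y-step
          absurd : ⊥
          absurd = falling⇒⊥ w w-≺ y->
            -- Position 1 of `w` has index at least 2 in the copy, so even the base edge below comes
            -- from an ordinary edge of the star.
            (let (u , e , u-D) = edges (1 ∷ I ++ [ suc n ]) (cons ≤-refl (s≤s z≤n) I′-ix) (cong suc (length-snoc I I-len)) in
               u , e , u-D 1 ≤-refl (s≤s z≤n))
            (λ J J-ix J-len → let (u , e , u-D) = edges J (Ix-weaken (n≤1+n 1) ≤-refl J-ix) J-len in
               u , e , λ a 2≤a a≤ → let eq = u-D a (<⇒≤ 2≤a) a≤ in
                 ≤-trans (<⇒≤ (y-> z≤n ≤-refl 1≤n)) (≤-reflexive (sym eq)) , ≤-reflexive eq)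

        absurd : ⊥
        absurd with anyUpTo? (λ i → D (p i) ≟ D (p (suc i))) r
        ... | yes (i , i<r , eq) = Constant.absurd i i<r eq
        ... | no none            = Distinct.absurd (λ i i<r eq → none (i , i<r , eq))

      -- The edge of I starts with its largest gap, so it is falling; hence y 1
      -- exceeds every gap within [2 , n + 1], and each edge with body there
      -- starts with its largest gap as well.
      module Falling (D<δ₀ : D (suc n) < δ (x 0) (x 1)) where

        x-≺ₙ : ∀ {i j} → i < j → j ≤ suc n → x i ≺ x j
        x-≺ₙ i<j j≤ = x-≺ i<j (≤-trans j≤ n<n′)
        len : length (map x (1 ∷ I ++ [ suc n ])) ≡ suc (suc k)
        len = trans (length-map x (1 ∷ I ++ [ suc n ])) (cong suc (length-snoc I I-len))
        I-falling : Linked _>_ (gaps δ (x 0) (map x (1 ∷ I ++ [ suc n ])))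
        I-falling = falling len base
          (All.map (λ q → ≤-<-trans q D<δ₀) (gaps-≤ n<n′ ≤-refl I′-ix))
        y₁-max : 1 < n → δ (x 2) (x (suc n)) < y 1
        y₁-max 1<n = go I-head I′-ix I-falling
          where
          go : _ → Ix 2 (suc n) (I ++ [ suc n ]) → Linked _>_ (gaps δ (x 0) (map x (1 ∷ I ++ [ suc n ]))) →
               δ (x 2) (x (suc n)) < y 1
          go (inj₁ (refl , _)) _ _ = contradiction 1<n (<-irrefl refl)
          -- As `I` begins with 2, the second gap of the base edge is `y 1`, and the later ones run
          -- from 2 to `suc n`.
          go (inj₂ (_ , I′ , refl)) (cons _ _ ixs) l = gaps-< {J = I′} n<n′ (s≤s 1<n) ixs (All-linked (Linked.tail l))
        edges : ∀ J → Ix 2 (suc n) J → length J ≡ suc (suc k) →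
                ∃ λ u → E (u ∷ map x J) × (∀ a → 2 ≤ a → a ≤ suc n → y 1 ≤ δ u (x a) × δ u (x a) ≤ y 0)
        edges J J-ix J-len with edge J (Ix-weaken ≤-refl n<n′ J-ix) J-len
        ... | u , x₀≼u , u≼x₁ , e = u , e , λ a 2≤a a≤ →
          -- `y 1` is `D 2`; a start `u` to the left of `x 1` can only enlarge `D a`, and at most to
          -- `y 0`.
          ≤-trans (δ-right ≤-refl 2≤a (≤-trans a≤ n<n′)) (lower u≼x₁ 2≤a a≤) , upper x₀≼u u≼x₁ 2≤a a≤
          where
          lower : ∀ {a} → (u ≡ x 1 ⊎ u ≺ x 1) → 2 ≤ a → a ≤ suc n → D a ≤ δ u (x a)
          lower (inj₁ refl) _ _ = ≤-refl
          lower {a} (inj₂ u≺x₁) 2≤a a≤ = subst (D a ≤_) (sym (δ-max u≺x₁ (x-≺ₙ 2≤a a≤))) (m≤n⊔m _ _)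
          D≤ : ∀ {a} → 2 ≤ a → a ≤ suc n → D a ≤ y 0
          D≤ 2≤a a≤ = ≤-trans (δ-right 2≤a a≤ n<n′) (<⇒≤ D<δ₀)
          upper : ∀ {a} → (x 0 ≡ u ⊎ x 0 ≺ u) → (u ≡ x 1 ⊎ u ≺ x 1) → 2 ≤ a → a ≤ suc n → δ u (x a) ≤ y 0
          upper _ (inj₁ refl) 2≤a a≤ = D≤ 2≤a a≤
          upper x₀≼u (inj₂ u≺x₁) 2≤a a≤ =
            subst (_≤ y 0) (sym (δ-max u≺x₁ (x-≺ₙ 2≤a a≤))) (⊔-lub (δu≤ x₀≼u) (D≤ 2≤a a≤))
            where
            δu≤ : (x 0 ≡ u ⊎ x 0 ≺ u) → δ u (x 1) ≤ y 0
            δu≤ (inj₁ refl) = ≤-refl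
            δu≤ (inj₂ x₀≺u) = subst (δ u (x 1) ≤_) (sym (δ-max x₀≺u u≺x₁)) (m≤n⊔m _ _)
        y-step : ∀ j → 0 ≤ j → suc j ≤ n → y (suc j) < y j
        y-step zero          _ j<n = ≤-<-trans (δ-right ≤-refl (s≤s j<n) n<n′) D<δ₀
        y-step (suc zero)    _ j<n = ≤-<-trans (δ-right ≤-refl (s≤s j<n) n<n′) (y₁-max j<n)
        y-step (suc (suc j)) _ j<n = higher I-head
          where
          1<n : 1 < n
          1<n = ≤-trans (s≤s (s≤s z≤n)) j<n
          higher : _ → y (suc (suc (suc j))) < y (suc (suc j))
          higher (inj₁ (refl , _)) = contradiction 1<n (<-irrefl refl)
          higher (inj₂ (k+2≤n , I′ , refl)) = interval-falling x x-≺ₙ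
            (λ J J-ix J-len → let (u , e , bounds) = edges J J-ix J-len in
               u , e , λ a 2≤a a≤ → <-≤-trans (y₁-max 1<n) (proj₁ (bounds a 2≤a a≤)))
            (subst (1 ≤_) I-len (s≤s z≤n)) (s≤s (s≤s k+2≤n)) (suc (suc j)) (s≤s (s≤s z≤n)) (s≤s j<n)
        absurd : ⊥
        absurd = falling⇒⊥ x x-≺ₙ (stepwise⇒ {_>_} (λ a b → <-trans b a) y y-step)
          (x 0 , base , refl) edges

      cases : _ → ⊥
      cases (tri< lt _ _) = Rising.absurd lt
      cases (tri≈ _ eq _) = δ-≢ x₀≺x₁ (x-≺ (s≤s 1≤n) n<n′) eq
      cases (tri> _ _ gt) = Falling.absurd gt

-- The highest differing digit and the stepped-up colouring

shift : ℕ → ℕ → ℕ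
shift zero    x = x
shift (suc d) x = ⌊ shift d x /2⌋

-- The search runs down from the highest digit; 0 is a default that distinct numbers below `2 ^ N`
-- never reach.
topBit : ℕ → ℕ → ℕ → ℕ
topBit zero    x y = 0
topBit (suc N) x y with shift N x ≟ shift N y
... | yes _ = topBit N x y
... | no  _ = N

shift-mono : ∀ d {x y} → x ≤ y → shift d x ≤ shift d y
shift-mono zero    p = p
shift-mono (suc d) p = ⌊n/2⌋-mono (shift-mono d p)

half-< : ∀ a b → a < 2 * b → ⌊ a /2⌋ < b
half-< a             zero    ()
half-< zero          (suc b) _ = s≤s z≤n
half-< (suc zero)    (suc b) _ = s≤s z≤n
half-< (suc (suc a)) (suc b) p =
  s≤s (half-< a b (≤-pred (≤-pred (subst (suc (suc (suc a)) ≤_) (cong suc (+-suc b (b + 0))) p))))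

shift-< : ∀ d j {x} → x < 2 ^ (d + j) → shift d x < 2 ^ j
shift-< zero    j p = p
shift-< (suc d) j {x} p = half-< _ (2 ^ j) (shift-< d (suc j) (subst (λ e → x < 2 ^ e) (sym (+-suc d j)) p))

shift-zero : ∀ N {x} → x < 2 ^ N → shift N x ≡ 0
shift-zero N {x} p = n<1⇒n≡0 (shift-< N 0 (subst (λ e → x < 2 ^ e) (sym (+-identityʳ N)) p))

-- Characterises δ(x, y) = d for `x < y` through binary prefixes, independently of the number of
-- digits searched.
TopBit : ℕ → ℕ → ℕ → Set
TopBit x y d = shift d x < shift d y × shift (suc d) x ≡ shift (suc d) y

topBit-spec : ∀ N {x y} → x < y → shift N x ≡ shift N y → TopBit x y (topBit N x y) × topBit N x y < N
topBit-spec zero    x<y eq = contradiction eq (<⇒≢ x<y)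
topBit-spec (suc N) {x} {y} x<y eq with shift N x ≟ shift N y
... | no  p = (≤∧≢⇒< (shift-mono N (<⇒≤ x<y)) p , eq) , ≤-refl
... | yes p = let (s , b) = topBit-spec N x<y p in s , m≤n⇒m≤1+n b

shift-above : ∀ {d e x y} → shift d x ≡ shift d y → d ≤ e → shift e x ≡ shift e y
shift-above {d} {zero}  p z≤n = p
shift-above {d} {suc e} p d≤e with m≤n⇒m<n∨m≡n d≤e
... | inj₂ refl = p
... | inj₁ d<e  = cong ⌊_/2⌋ (shift-above p (≤-pred d<e))

TopBit-unique : ∀ {x y d e} → TopBit x y d → TopBit x y e → d ≡ e
TopBit-unique {d = d} {e} (d< , d≡) (e< , e≡) with <-cmp d e
... | tri≈ _ p _ = p
... | tri< p _ _ = contradiction (shift-above d≡ p) (<⇒≢ e<)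
... | tri> _ _ p = contradiction (shift-above e≡ p) (<⇒≢ d<)

-- At most two numbers share a half. Equal adjacent gaps would give three prefixes with the same
-- half, whence `δ-≢`.
no-three : ∀ {a b c} → a < b → b < c → ⌊ a /2⌋ ≢ ⌊ c /2⌋
no-three {a} {b} {c} a<b b<c eq = <⇒≢ (⌊n/2⌋-mono (≤-trans (s≤s a<b) b<c)) eq

topBit-gap : ∀ N → GapFunction (_<[ 2 ^ N ]_) (topBit N) N
topBit-gap N = record { δ-max = δ-max ; δ-≢ = δ-≢ ; δ-bound = λ p → proj₂ (spec p) }
  where
  spec : ∀ {x y} → x <[ 2 ^ N ] y → TopBit x y (topBit N x y) × topBit N x y < N
  spec (x<y , y<) = topBit-spec N x<y (trans (shift-zero N (<-trans x<y y<)) (sym (shift-zero N y<)))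
  tb : ∀ {x y} → x <[ 2 ^ N ] y → TopBit x y (topBit N x y)
  tb p = proj₁ (spec p)
  δ-≢ : ∀ {x y z} → x <[ 2 ^ N ] y → y <[ 2 ^ N ] z → topBit N x y ≢ topBit N y z
  δ-≢ {x} {y} {z} p q eq = no-three (proj₁ (tb p)) (subst (λ d → shift d y < shift d z) (sym eq) (proj₁ (tb q)))
    (trans (proj₂ (tb p)) (subst (λ d → shift (suc d) y ≡ shift (suc d) z) (sym eq) (proj₂ (tb q))))
  δ-max : ∀ {x y z} → x <[ 2 ^ N ] y → y <[ 2 ^ N ] z → topBit N x z ≡ topBit N x y ⊔ topBit N y z
  δ-max {x} {y} {z} p@(x<y , _) q@(y<z , z<) with <-cmp (topBit N x y) (topBit N y z) | tb p | tb q
  ... | tri≈ _ eq _ | _ | _ = contradiction eq (δ-≢ p q)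
  -- `x` and `y` agree from the digit `topBit N y z` upwards, so this is also the highest difference
  -- of `x` and `z`. The other case is symmetric.
  ... | tri< lt _ _ | (p< , p≡) | (q< , q≡) = trans
    (TopBit-unique (tb (<-trans x<y y<z , z<)) (subst (_< _) (sym (shift-above p≡ lt)) q< , trans (shift-above p≡ (m≤n⇒m≤1+n lt)) q≡))
    (sym (m≤n⇒m⊔n≡n (<⇒≤ lt)))
  ... | tri> _ _ gt | (p< , p≡) | (q< , q≡) = trans
    (TopBit-unique (tb (<-trans x<y y<z , z<)) (subst (shift (topBit N x y) x <_) (shift-above q≡ gt) p< , trans p≡ (shift-above q≡ (m≤n⇒m≤1+n gt))))
    (sym (m≥n⇒m⊔n≡m (<⇒≤ gt)))

flip-gap : ∀ {_≺_ δ N} → GapFunction _≺_ δ N → GapFunction (flip _≺_) (flip δ) N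
flip-gap {δ = δ} g = record
  { δ-max   = λ p q → trans (δ-max q p) (⊔-comm (δ _ _) (δ _ _))
  ; δ-≢     = λ p q eq → δ-≢ q p (sym eq)
  ; δ-bound = δ-bound }
  where open GapFunction g

-- Reversal of lists and the stepped-up colouring

reverse-linked : ∀ {_~_ : ℕ → ℕ → Set} {l} → Linked _~_ l → Linked (flip _~_) (reverse l)
reverse-linked {_~_} {[]}    _ = []
reverse-linked {_~_} {a ∷ l} p = go p [-]
  where
  go : ∀ {a l acc} → Linked _~_ (a ∷ l) → Linked (flip _~_) (a ∷ acc) → Linked (flip _~_) (l ʳ++ (a ∷ acc))
  go [-]      q = q
  go (r ∷ rs) q = go rs (r ∷ q)

Δ : (ℕ → ℕ → ℕ) → List ℕ → List ℕ
Δ δ []      = []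
Δ δ (u ∷ l) = gaps δ u l

-- A reversed copy lists its edges downwards; this relates the gaps read in that order to those seen
-- by `stepUp`.
Δ-reverse : ∀ δ l → Δ δ (reverse l) ≡ reverse (Δ (flip δ) l)
Δ-reverse δ []      = refl
Δ-reverse δ (u ∷ l) = go u l []
  where
  go : ∀ u l acc → Δ δ (l ʳ++ (u ∷ acc)) ≡ gaps (flip δ) u l ʳ++ Δ δ (u ∷ acc)
  go u []      acc = refl
  go u (a ∷ l) acc = go a l (u ∷ acc)

first : List ℕ → ℕ
first []      = 0
first (d ∷ _) = d

-- The left side is the last entry, which differs from the head once there are two entries.
first-reverse : ∀ {d e l} → HeadMax (d ∷ e ∷ l) → first (reverse (d ∷ e ∷ l)) < d
first-reverse {d} (p ∷ ps) = go p ps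
  where
  go : ∀ {e l acc} → e < d → All (_< d) l → first ((e ∷ l) ʳ++ acc) < d
  go p []       = p
  go p (q ∷ qs) = go q qs

Colour : Set
Colour = Bool × Bool

swap : Colour → Colour
swap (s , b) = not s , b

swap-swap : ∀ c → swap (swap c) ≡ c
swap-swap (true  , b) = refl
swap-swap (false , b) = refl

module StepColouring (χ : List ℕ → Colour) where

  rising? : ∀ l → Dec (Linked _<_ l)
  rising? = Linked.linked? _<?_

  falling? : ∀ l → Dec (Linked _>_ l)
  falling? = Linked.linked? _>?_

  -- The side of a colour says whether it avoids copies (false) or reversed
  -- copies (true).  A list that is not monotone is put on the side for which
  -- its largest entry cannot be the one next to the vertex x_J.
  colour : List ℕ → Colour
  colour d with rising? d | falling? d | first (reverse d) <? first d
  ... | yes _ | _     | _     = χ d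
  ... | no _  | yes _ | _     = swap (χ (reverse d))
  ... | no _  | no _  | yes _ = true , false
  ... | no _  | no _  | no _  = false , false

  colour-rising : ∀ {d} → Linked _<_ d → colour d ≡ χ d
  colour-rising {d} p with rising? d | falling? d | first (reverse d) <? first d
  ... | yes _ | _     | _     = refl
  ... | no ¬p | _     | _     = contradiction p ¬p

  -- Lists of at most one entry are rising as well and keep the colour `χ d`, hence the condition on
  -- the length.
  colour-falling : ∀ d {m} → length d ≡ suc (suc m) → Linked _>_ d → colour d ≡ swap (χ (reverse d))
  colour-falling d@(_ ∷ _ ∷ _) _ p with rising? d | falling? d | first (reverse d) <? first d
  ... | yes q | _     | _     = contradiction (Linked.head p) (<⇒≯ (Linked.head q))
  ... | no _  | yes _ | _     = refl
  ... | no _  | no ¬p | _     = contradiction p ¬p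

  colour-false : ∀ {d c} → colour d ≡ (false , c) → first (reverse d) < first d → Linked _<_ d ⊎ Linked _>_ d
  colour-false {d} e lt with rising? d | falling? d | first (reverse d) <? first d
  ... | yes p | _     | _     = inj₁ p
  ... | no _  | yes p | _     = inj₂ p
  ... | no _  | no _  | no ¬p = contradiction lt ¬p
  colour-false {d} () lt | no _ | no _ | yes _

  colour-true : ∀ d {c} → colour d ≡ (true , c) → first d < first (reverse d) → Linked _<_ d ⊎ Linked _>_ d
  colour-true d e lt with rising? d | falling? d | first (reverse d) <? first d
  ... | yes p | _     | _     = inj₁ p
  ... | no _  | yes p | _     = inj₂ p
  ... | no _  | no _  | yes p = contradiction p (<⇒≯ lt)
  colour-true d () lt | no _ | no _ | no _

stepUp : ℕ → (List ℕ → Colour) → List ℕ → Colour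
stepUp N χ l = StepColouring.colour χ (Δ (topBit N) l)

module _ {χ : List ℕ → Colour} {N k r n : ℕ} {I : List ℕ}
  (no-clique : ∀ b → ¬ Clique _<[ N ]_ (λ l → χ l ≡ (false , b)) (suc (suc k)) r)
  (no-copy : ∀ b → ¬ Copy (flip _<[ N ]_) (λ l → χ (reverse l) ≡ (true , b)) (suc k) n (1 ∷ I))
  (1≤n : 1 ≤ n) (I-ix : Ix 2 n I) (I-len : length I ≡ k)
  (I-head : (n ≡ 1 × I ≡ []) ⊎ (suc (suc k) ≤ n × ∃ λ I′ → I ≡ 2 ∷ I′))
  {n′ : ℕ} (n′-big : suc n + r * n ≤ n′) where

  open StepColouring χ

  stepUp-copy : ∀ b → ¬ Copy _<[ 2 ^ N ]_ (λ l → stepUp N χ l ≡ (false , b)) (suc (suc k)) n′ (1 ∷ I ++ [ suc n ])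
  stepUp-copy b = Step.copy⇒⊥ (topBit-gap N) {C = λ l → χ l ≡ (false , b)} {R = λ l → χ (reverse l) ≡ (true , b)}
    (λ _ e p → trans (sym (colour-rising p)) e) to-R falling
    (no-clique b) (no-copy b) 1≤n I-ix I-len I-head n′-big
    where
    δ = topBit N
    to-R : ∀ {u l} → length l ≡ suc (suc k) → stepUp N χ (u ∷ l) ≡ (false , b) → Linked _>_ (gaps δ u l) →
           χ (reverse (gaps δ u l)) ≡ (true , b)
    to-R {u} {l@(_ ∷ _ ∷ _)} _ e p = trans (sym (swap-swap _)) (cong swap (trans (sym (colour-falling (gaps δ u l) refl p)) e))
    falling : ∀ {u l} → length l ≡ suc (suc k) → stepUp N χ (u ∷ l) ≡ (false , b) → HeadMax (gaps δ u l) → Linked _>_ (gaps δ u l)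
    falling {l = _ ∷ _ ∷ _} _ e h with colour-false e (first-reverse h)
    ... | inj₂ p = p
    ... | inj₁ p = contradiction (Linked.head p) (<⇒≯ (All.head h))

  -- A list rising for the flipped gaps is falling for `colour`, so the reversal and the exchange of
  -- sides cancel: both sides need the same two exclusions one level down.
  stepUp-rev : ∀ b → ¬ Copy (flip _<[ 2 ^ N ]_) (λ l → stepUp N χ (reverse l) ≡ (true , b)) (suc (suc k)) n′ (1 ∷ I ++ [ suc n ])
  stepUp-rev b = Step.copy⇒⊥ (flip-gap (topBit-gap N)) {C = λ l → χ l ≡ (false , b)} {R = λ l → χ (reverse l) ≡ (true , b)}
    to-C to-R falling
    (no-clique b) (no-copy b) 1≤n I-ix I-len I-head n′-big
    where
    δ = flip (topBit N)
    unreverse : ∀ {l} → stepUp N χ (reverse l) ≡ (true , b) → colour (reverse (Δ δ l)) ≡ (true , b)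
    unreverse {l} e = trans (cong colour (sym (Δ-reverse (topBit N) l))) e
    to-C : ∀ {u l} → length l ≡ suc (suc k) → stepUp N χ (reverse (u ∷ l)) ≡ (true , b) → Linked _<_ (gaps δ u l) →
           χ (gaps δ u l) ≡ (false , b)
    to-C {u} {l@(_ ∷ _ ∷ _)} _ e p = trans (cong χ (sym (reverse-involutive (gaps δ u l))))
      (trans (sym (swap-swap (χ (reverse (reverse (gaps δ u l)))))) (cong swap (trans (sym (colour-falling (reverse (gaps δ u l)) (length-reverse (gaps δ u l)) (reverse-linked p))) (unreverse {u ∷ l} e))))
    to-R : ∀ {u l} → length l ≡ suc (suc k) → stepUp N χ (reverse (u ∷ l)) ≡ (true , b) → Linked _>_ (gaps δ u l) →
           χ (reverse (gaps δ u l)) ≡ (true , b)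
    to-R {u} {l} _ e p = trans (sym (colour-rising (reverse-linked p))) (unreverse {u ∷ l} e)
    falling : ∀ {u l} → length l ≡ suc (suc k) → stepUp N χ (reverse (u ∷ l)) ≡ (true , b) → HeadMax (gaps δ u l) → Linked _>_ (gaps δ u l)
    falling {u} {l@(_ ∷ _ ∷ _)} _ e h
      with colour-true (reverse d) (unreverse {u ∷ l} e)
             (subst (first (reverse d) <_) (cong first (sym (reverse-involutive d))) (first-reverse h))
      where d = gaps δ u l
    ... | inj₁ p = subst (Linked _>_) (reverse-involutive (gaps δ u l)) (reverse-linked {l = reverse (gaps δ u l)} p)
    ... | inj₂ p = contradiction
      (Linked.head (subst (Linked _<_) (reverse-involutive (gaps δ u l)) (reverse-linked {l = reverse (gaps δ u l)} p))) (<⇒≯ (All.head h))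

-- The counting bound for pairs

module _ {Var : Set} where

  -- A clause (μ , c) forbids the assignments that are constantly c on the
  -- variables selected by μ; weight counts the forbidden assignments.
  Clause : Set
  Clause = (Var → Bool) × Bool

  weight : List Var → (Var → Bool) → ℕ
  weight []       μ = 1
  weight (v ∷ vs) μ = (if μ v then 1 else 2) * weight vs μ

  total : List Var → List Clause → ℕ
  total vs []              = 0
  total vs ((μ , _) ∷ cls) = weight vs μ + total vs cls

  Avoids : (Var → Bool) → List Var → Clause → Set
  Avoids f vs (μ , c) = ∃ λ v → v ∈ vs × μ v ≡ true × f v ≡ not c

  weight-++ : ∀ us vs μ → weight (us ++ vs) μ ≡ weight us μ * weight vs μ
  weight-++ []       vs μ = sym (+-identityʳ _)
  weight-++ (u ∷ us) vs μ = trans (cong ((if μ u then 1 else 2) *_) (weight-++ us vs μ))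
    (sym (*-assoc (if μ u then 1 else 2) (weight us μ) (weight vs μ)))

  kills : Bool → Bool → Bool → Bool
  kills selected c b = selected ∧ (c xor b)

  kills⁻ : ∀ s c b → kills s c b ≡ true → s ≡ true × b ≡ not c
  kills⁻ true true  false _ = refl , refl
  kills⁻ true false true  _ = refl , refl

  -- A clause already avoided by giving `v` the value `b` is dropped; a surviving one keeps its `μ`,
  -- as `weight` looks only at the listed variables.
  restrict : Var → Bool → List Clause → List Clause
  restrict v b [] = []
  restrict v b ((μ , c) ∷ cls) =
    if kills (μ v) c b then restrict v b cls else (μ , c) ∷ restrict v b cls

  -- Forbidden assignments are split by their value at `v`; a clause that selects `v` survives only
  -- for its own value.
  total-restrict : ∀ v vs cls →
    total vs (restrict v true cls) + total vs (restrict v false cls) ≡ total (v ∷ vs) cls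
  total-restrict v vs [] = refl
  total-restrict v vs ((μ , c) ∷ cls) rewrite sym (total-restrict v vs cls) with μ v | c
  ... | false | _     = solve 3 (λ w a b → (w :+ a) :+ (w :+ b) := (w :+ (w :+ con 0)) :+ (a :+ b)) refl
                          (weight vs μ) (total vs (restrict v true cls)) (total vs (restrict v false cls))
    where open +-*-Solver
  ... | true  | true  = solve 3 (λ w a b → (w :+ a) :+ b := (w :+ con 0) :+ (a :+ b)) refl
                          (weight vs μ) (total vs (restrict v true cls)) (total vs (restrict v false cls))
    where open +-*-Solver
  ... | true  | false = solve 3 (λ w a b → a :+ (w :+ b) := (w :+ con 0) :+ (a :+ b)) refl
                          (weight vs μ) (total vs (restrict v true cls)) (total vs (restrict v false cls))
    where open +-*-Solver

  module _ (_≟ᵥ_ : DecidableEquality Var) where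

    update : Var → Bool → (Var → Bool) → Var → Bool
    update v b f u = if does (u ≟ᵥ v) then b else f u

    update-same : ∀ v b f → update v b f v ≡ b
    update-same v b f rewrite dec-true (v ≟ᵥ v) refl = refl

    update-other : ∀ {u v} b f → u ≢ v → update v b f u ≡ f u
    update-other {u} {v} b f u≢v rewrite dec-false (u ≟ᵥ v) u≢v = refl

    module _ (v : Var) (b : Bool) (f : Var → Bool) (vs : List Var) (v∉vs : All (v ≢_) vs) where

      lift-avoids : ∀ {cl} → Avoids f vs cl → Avoids (update v b f) (v ∷ vs) cl
      lift-avoids (u , u∈ , μu , fu) =
        u , there u∈ , μu , trans (update-other b f (λ u≡v → All.lookup v∉vs u∈ (sym u≡v))) fu

      extend : ∀ cls → All (Avoids f vs) (restrict v b cls) → All (Avoids (update v b f) (v ∷ vs)) cls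
      extend [] _ = []
      extend ((μ , c) ∷ cls) ps with kills (μ v) c b in eq
      extend ((μ , c) ∷ cls) (p ∷ ps) | false = lift-avoids p ∷ extend cls ps
      extend ((μ , c) ∷ cls) ps       | true  =
        (v , here refl , proj₁ (kills⁻ (μ v) c b eq) , trans (update-same v b f) (proj₂ (kills⁻ (μ v) c b eq)))
        ∷ extend cls ps

    -- The method of conditional expectations: the two values of `v` share the total, so one of them
    -- stays below `2 ^ length vs`. With no variables left every clause weighs 1, so no clause
    -- remains.
    satisfiable : ∀ vs → Unique vs → ∀ cls → total vs cls < 2 ^ length vs → ∃ λ f → All (Avoids f vs) cls
    satisfiable [] _ []        _       = (λ _ → true) , []
    satisfiable [] _ (_ ∷ cls) (s≤s ())
    satisfiable (v ∷ vs) (v∉vs ∷ u) cls small with total vs (restrict v true cls) <? 2 ^ length vs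
    ... | yes lt = let (f , av) = satisfiable vs u _ lt in update v true f , extend v true f vs v∉vs cls av
    ... | no ≮   = let (f , av) = satisfiable vs u _ lt in update v false f , extend v false f vs v∉vs cls av
      where
      A = total vs (restrict v true cls)
      B = total vs (restrict v false cls)
      lt : B < 2 ^ length vs
      lt = +-cancelˡ-< (2 ^ length vs) B (2 ^ length vs) (begin-strict
        2 ^ length vs + B              ≤⟨ +-monoˡ-≤ B (≮⇒≥ ≮) ⟩
        A + B                          ≡⟨ total-restrict v vs cls ⟩
        total (v ∷ vs) cls             <⟨ small ⟩
        2 ^ length vs + (2 ^ length vs + 0) ≡⟨ cong (2 ^ length vs +_) (+-identityʳ _) ⟩
        2 ^ length vs + 2 ^ length vs  ∎)
        where open ≤-Reasoning

  total-≡ : ∀ vs e cls → All (λ cl → 2 ^ e * weight vs (proj₁ cl) ≡ 2 ^ length vs) cls →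
            2 ^ e * total vs cls ≡ length cls * 2 ^ length vs
  total-≡ vs e []              []       = *-zeroʳ (2 ^ e)
  total-≡ vs e ((μ , _) ∷ cls) (p ∷ ps) =
    trans (*-distribˡ-+ (2 ^ e) (weight vs μ) (total vs cls)) (cong₂ _+_ p (total-≡ vs e cls ps))

  -- The union bound, where each clause forbids a fraction 1 / 2^e of all assignments.
  total-< : ∀ vs e cls → All (λ cl → 2 ^ e * weight vs (proj₁ cl) ≡ 2 ^ length vs) cls →
            length cls < 2 ^ e → total vs cls < 2 ^ length vs
  total-< vs e cls ps few = *-cancelˡ-< (2 ^ e) _ _ (begin-strict
    2 ^ e * total vs cls         ≡⟨ total-≡ vs e cls ps ⟩
    length cls * 2 ^ length vs   <⟨ *-monoˡ-< (2 ^ length vs) {{m^n≢0 2 (length vs)}} few ⟩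
    2 ^ e * 2 ^ length vs        ∎)
    where open ≤-Reasoning

-- Erdős's colouring of pairs

pairs : List ℕ → List (ℕ × ℕ)
pairs []      = []
pairs (x ∷ l) = map (x ,_) l ++ pairs l

∈-pairs⁻ : ∀ {p} l → p ∈ pairs l → proj₁ p ∈ l × proj₂ p ∈ l
∈-pairs⁻ (x ∷ l) p∈ with ∈-++⁻ (map (x ,_) l) p∈
... | inj₁ q with ∈-map⁻ (x ,_) q
...   | _ , y∈ , refl = here refl , there y∈
∈-pairs⁻ (x ∷ l) p∈ | inj₂ q = let (a , b) = ∈-pairs⁻ l q in there a , there b

pairs-unique : ∀ {l} → Unique l → Unique (pairs l)
pairs-unique [] = []
pairs-unique {x ∷ l} (x∉ ∷ u) = Uniqueₚ.++⁺ (Uniqueₚ.map⁺ ,-injectiveʳ u) (pairs-unique u) disjoint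
  where
  disjoint : ∀ {p} → p ∈ map (x ,_) l × p ∈ pairs l → ⊥
  disjoint (p , q) with ∈-map⁻ (x ,_) p
  ... | _ , _ , refl = All.lookup x∉ (proj₁ (∈-pairs⁻ l q)) refl

both : (ℕ → Bool) → ℕ × ℕ → Bool
both S (i , j) = S i ∧ S j

count : (ℕ → Bool) → List ℕ → ℕ
count S []      = 0
count S (x ∷ l) = (if S x then 1 else 0) + count S l

-- The binomial coefficient s choose 2.
triangle : ℕ → ℕ
triangle zero    = 0
triangle (suc s) = s + triangle s

weight-row : ∀ S x l → S x ≡ true → 2 ^ count S l * weight (map (x ,_) l) (both S) ≡ 2 ^ length l
weight-row S x []      _  = refl
weight-row S x (y ∷ l) Sx rewrite Sx with S y | weight-row S x l Sx
... | true  | ih = trans (solve 2 (λ a b → (a :+ (a :+ con 0)) :* (b :+ con 0) := a :* b :+ (a :* b :+ con 0)) refl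
                     (2 ^ count S l) (weight (map (x ,_) l) (both S))) (cong (2 *_) ih)
  where open +-*-Solver
... | false | ih = trans (solve 2 (λ a b → a :* (b :+ (b :+ con 0)) := a :* b :+ (a :* b :+ con 0)) refl
                     (2 ^ count S l) (weight (map (x ,_) l) (both S))) (cong (2 *_) ih)
  where open +-*-Solver

weight-row₀ : ∀ S x l → S x ≡ false → weight (map (x ,_) l) (both S) ≡ 2 ^ length l
weight-row₀ S x []      _  = refl
weight-row₀ S x (y ∷ l) Sx rewrite Sx = cong (2 *_) (weight-row₀ S x l Sx)

length-pairs : ∀ x l → 2 ^ length l * 2 ^ length (pairs l) ≡ 2 ^ length (pairs (x ∷ l))
length-pairs x l = begin
  2 ^ length l * 2 ^ length (pairs l)               ≡⟨ ^-distribˡ-+-* 2 (length l) (length (pairs l)) ⟨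
  2 ^ (length l + length (pairs l))                 ≡⟨ cong (λ a → 2 ^ (a + length (pairs l))) (length-map (x ,_) l) ⟨
  2 ^ (length (map (x ,_) l) + length (pairs l))    ≡⟨ cong (2 ^_) (length-++ (map (x ,_) l)) ⟨
  2 ^ length (pairs (x ∷ l))                        ∎
  where open ≡-Reasoning

-- Counted row by row, the pairs inside `S` number `triangle (count S l)`, and each of them fixes
-- one variable.
weight-pairs : ∀ S l → 2 ^ triangle (count S l) * weight (pairs l) (both S) ≡ 2 ^ length (pairs l)
weight-pairs S []      = refl
weight-pairs S (x ∷ l) with S x in Sx | weight-pairs S l
... | true | ih = begin
  2 ^ (c + triangle c) * weight (row ++ pairs l) (both S)
    ≡⟨ cong₂ _*_ (^-distribˡ-+-* 2 c (triangle c)) (weight-++ row (pairs l) (both S)) ⟩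
  2 ^ c * 2 ^ triangle c * (weight row (both S) * weight (pairs l) (both S))
    ≡⟨ [m*n]*[o*p]≡[m*o]*[n*p] (2 ^ c) (2 ^ triangle c) (weight row (both S)) _ ⟩
  2 ^ c * weight row (both S) * (2 ^ triangle c * weight (pairs l) (both S))
    ≡⟨ cong₂ _*_ (weight-row S x l Sx) ih ⟩
  2 ^ length l * 2 ^ length (pairs l)
    ≡⟨ length-pairs x l ⟩
  2 ^ length (row ++ pairs l) ∎
  where
  open ≡-Reasoning
  c = count S l
  row = map (x ,_) l
... | false | ih = begin
  2 ^ triangle c * weight (row ++ pairs l) (both S)
    ≡⟨ cong (2 ^ triangle c *_) (weight-++ row (pairs l) (both S)) ⟩
  2 ^ triangle c * (weight row (both S) * weight (pairs l) (both S))
    ≡⟨ x∙yz≈y∙xz (2 ^ triangle c) (weight row (both S)) _ ⟩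
  weight row (both S) * (2 ^ triangle c * weight (pairs l) (both S))
    ≡⟨ cong₂ _*_ (weight-row₀ S x l Sx) ih ⟩
  2 ^ length l * 2 ^ length (pairs l)
    ≡⟨ length-pairs x l ⟩
  2 ^ length (row ++ pairs l) ∎
  where
  open ≡-Reasoning
  open import Algebra.Properties.CommutativeSemigroup *-commutativeSemigroup using (x∙yz≈y∙xz)
  c = count S l
  row = map (x ,_) l

-- Subsets are listed from the top to match the recursion of `downFrom`.
Descending : ℕ → List ℕ → Set
Descending N []      = ⊤
Descending N (x ∷ S) = x < N × Descending x S

Descending-weaken : ∀ {M N} S → M ≤ N → Descending M S → Descending N S
Descending-weaken []      _ _       = tt
Descending-weaken (x ∷ S) p (q , d) = ≤-trans q p , d

mem : List ℕ → ℕ → Bool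
mem []      y = false
mem (x ∷ S) y = does (x ≟ y) ∨ mem S y

mem-above : ∀ {N y} S → Descending N S → N ≤ y → mem S y ≡ false
mem-above []      _       _ = refl
mem-above {y = y} (x ∷ S) (p , d) N≤y
  rewrite dec-false (x ≟ y) (<⇒≢ (≤-trans p N≤y)) = mem-above S d (≤-trans (<⇒≤ p) N≤y)

count-cong : ∀ {S T} N → (∀ y → y < N → S y ≡ T y) → count S (downFrom N) ≡ count T (downFrom N)
count-cong zero    p = refl
count-cong (suc N) p =
  cong₂ (λ b c → (if b then 1 else 0) + c) (p N ≤-refl) (count-cong N (λ y y< → p y (m≤n⇒m≤1+n y<)))

count-mem : ∀ N S → Descending N S → count (mem S) (downFrom N) ≡ length S
count-mem zero    []      _        = refl
count-mem zero    (x ∷ S) (() , _)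
count-mem (suc N) []      _        = count-mem N [] tt
count-mem (suc N) (x ∷ S) (x<N , d) with m≤n⇒m<n∨m≡n (≤-pred x<N)
... | inj₁ x<N′ rewrite mem-above (x ∷ S) (x<N′ , d) ≤-refl = count-mem N (x ∷ S) (x<N′ , d)
... | inj₂ refl rewrite dec-true (x ≟ x) refl = cong suc (trans
        (count-cong x (λ y y<x → cong (_∨ mem S y) (dec-false (x ≟ y) (λ x≡y → <⇒≢ y<x (sym x≡y)))))
        (count-mem x S d))

choose : ℕ → ℕ → List (List ℕ)
choose zero    N       = [ [] ]
choose (suc s) zero    = []
choose (suc s) (suc N) = map (N ∷_) (choose s N) ++ choose (suc s) N

choose-sound : ∀ s N → All (λ S → Descending N S × length S ≡ s) (choose s N)
choose-sound zero    N       = (tt , refl) ∷ []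
choose-sound (suc s) zero    = []
choose-sound (suc s) (suc N) = Allₚ.++⁺
  (Allₚ.map⁺ (All.map (λ (d , l) → (≤-refl , d) , cong suc l) (choose-sound s N)))
  (All.map (λ {S} (d , l) → Descending-weaken S (n≤1+n N) d , l) (choose-sound (suc s) N))

choose-complete : ∀ N S → Descending N S → S ∈ choose (length S) N
choose-complete N       []      _         = here refl
choose-complete zero    (x ∷ S) (() , _)
choose-complete (suc N) (x ∷ S) (x<N , d) with m≤n⇒m<n∨m≡n (≤-pred x<N)
... | inj₂ refl = ∈-++⁺ˡ (∈-map⁺ (x ∷_) (choose-complete x S d))
... | inj₁ x<N′ = ∈-++⁺ʳ (map (N ∷_) (choose (length S) N)) (choose-complete N (x ∷ S) (x<N′ , d))

length-choose : ∀ s N → length (choose s N) ≤ N ^ s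
length-choose zero    N       = ≤-refl
length-choose (suc s) zero    = z≤n
length-choose (suc s) (suc N) = begin
  length (map (N ∷_) (choose s N) ++ choose (suc s) N)
    ≡⟨ length-++ (map (N ∷_) (choose s N)) ⟩
  length (map (N ∷_) (choose s N)) + length (choose (suc s) N)
    ≡⟨ cong (_+ length (choose (suc s) N)) (length-map (N ∷_) (choose s N)) ⟩
  length (choose s N) + length (choose (suc s) N)
    ≤⟨ +-mono-≤ (length-choose s N) (length-choose (suc s) N) ⟩
  N ^ s + N * N ^ s
    ≤⟨ *-monoʳ-≤ (suc N) (^-monoˡ-≤ s (n≤1+n N)) ⟩
  suc N * suc N ^ s ∎
  where open ≤-Reasoning

triangle-double : ∀ s → 2 * triangle s + s ≡ s * s
triangle-double zero    = refl
triangle-double (suc s) = trans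
  (solve 2 (λ s t → con 2 :* (s :+ t) :+ (con 1 :+ s) := (con 2 :* t :+ s) :+ (con 2 :* s :+ con 1)) refl s (triangle s))
  (trans (cong (_+ (2 * s + 1)) (triangle-double s))
    (solve 1 (λ s → s :* s :+ (con 2 :* s :+ con 1) := (con 1 :+ s) :* (con 1 :+ s)) refl s))
  where open +-*-Solver

-- In exponents, 2 · (2^m)^s < 2^(s choose 2). Doubling both sides avoids a division by 2.
triangle-big : ∀ m s → 2 * m + 4 ≤ s → suc (m * s) < triangle s
triangle-big m s big = *-cancelˡ-< 2 _ _ (+-cancelʳ-< s _ _ (begin-strict
  2 * suc (m * s) + s    ≡⟨ solve 2 (λ m s → con 2 :* (con 1 :+ m :* s) :+ s := con 2 :* m :* s :+ s :+ con 2) refl m s ⟩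
  2 * m * s + s + 2      <⟨ +-monoʳ-< (2 * m * s + s) (≤-trans (s≤s (s≤s (s≤s z≤n))) 4≤s) ⟩
  2 * m * s + s + s      ≤⟨ m≤m+n _ (2 * s) ⟩
  2 * m * s + s + s + 2 * s ≡⟨ solve 2 (λ m s → con 2 :* m :* s :+ s :+ s :+ con 2 :* s := (con 2 :* m :+ con 4) :* s) refl m s ⟩
  (2 * m + 4) * s        ≤⟨ *-monoˡ-≤ s big ⟩
  s * s                  ≡⟨ triangle-double s ⟨
  2 * triangle s + s     ∎))
  where
  open ≤-Reasoning
  open +-*-Solver
  4≤s : 4 ≤ s
  4≤s = ≤-trans (m≤n+m 4 (2 * m)) big

Meets : (ℕ × ℕ → Bool) → List ℕ → Bool → Set
Meets f S c = ∃ λ i → ∃ λ j → j < i × mem S i ≡ true × mem S j ≡ true × f (i , j) ≡ c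

-- Two clauses for each s-subset make at most 2 · 2^(ms) clauses, each fixing `triangle s` pairs.
erdős : ∀ m s → 2 * m + 4 ≤ s →
        ∃ λ f → ∀ S c → Descending (2 ^ m) S → length S ≡ s → Meets f S (not c)
erdős m s big = f , λ { S c d refl → found S c (All.lookup avoids (clause∈ c (choose-complete N S d))) }
  where
  N = 2 ^ m
  vs = pairs (downFrom N)
  clauses : Bool → List Clause
  clauses c = map (λ S → both (mem S) , c) (choose s N)
  cls : List Clause
  cls = clauses true ++ clauses false
  clause∈ : ∀ c {S} → S ∈ choose s N → (both (mem S) , c) ∈ cls
  clause∈ true  S∈ = ∈-++⁺ˡ (∈-map⁺ _ S∈)
  clause∈ false S∈ = ∈-++⁺ʳ (clauses true) (∈-map⁺ _ S∈)
  weights : ∀ c → All (λ cl → 2 ^ triangle s * weight vs (proj₁ cl) ≡ 2 ^ length vs) (clauses c)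
  weights c = Allₚ.map⁺ (All.map
    (λ { {S} (d , refl) → subst (λ a → 2 ^ triangle a * weight vs (both (mem S)) ≡ 2 ^ length vs)
                            (count-mem N S d) (weight-pairs (mem S) (downFrom N)) })
    (choose-sound s N))
  few : length cls < 2 ^ triangle s
  few = begin-strict
    length cls                                   ≡⟨ length-++ (clauses true) ⟩
    length (clauses true) + length (clauses false)
      ≡⟨ cong₂ _+_ (length-map _ (choose s N)) (length-map _ (choose s N)) ⟩
    length (choose s N) + length (choose s N)    ≤⟨ +-mono-≤ (length-choose s N) (length-choose s N) ⟩
    N ^ s + N ^ s                                ≡⟨ cong (N ^ s +_) (+-identityʳ (N ^ s)) ⟨
    2 * N ^ s                                    ≡⟨ cong (2 *_) (^-*-assoc 2 m s) ⟩
    2 ^ suc (m * s)                              <⟨ ^-monoʳ-< 2 (s≤s (s≤s z≤n)) (triangle-big m s big) ⟩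
    2 ^ triangle s                               ∎
    where open ≤-Reasoning
  solution = satisfiable (≡-dec _≟_ _≟_) vs (pairs-unique (Uniqueₚ.downFrom⁺ N)) cls
    (total-< vs (triangle s) cls (Allₚ.++⁺ (weights true) (weights false)) few)
  f = proj₁ solution
  avoids = proj₂ solution
  pair-> : ∀ M {i j} → (i , j) ∈ pairs (downFrom M) → j < i
  pair-> (suc M) p with ∈-++⁻ (map (M ,_) (downFrom M)) p
  ... | inj₂ q = pair-> M q
  ... | inj₁ q with ∈-map⁻ (M ,_) q
  ...   | _ , y∈ , refl = ∈-downFrom⁻ y∈
  split : ∀ a {b} → a ∧ b ≡ true → a ≡ true × b ≡ true
  split true p = refl , p
  found : ∀ S c → Avoids f vs (both (mem S) , c) → Meets f S (not c)
  found S c ((i , j) , p , both≡ , fij) =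
    let (i∈ , j∈) = split (mem S i) both≡ in i , j , pair-> N p , i∈ , j∈ , fij

-- Only side `false` occurs, so at this level reversed copies on side `true` are impossible. `f` is
-- read at (larger, smaller), as in `pairs (downFrom N)`.
pairColouring : (ℕ × ℕ → Bool) → List ℕ → Colour
pairColouring f (i ∷ j ∷ []) = false , f (j , i)
pairColouring f _            = false , false

clique⇒constant : ∀ {N f b r} → 1 ≤ r → Clique _<[ N ]_ (λ l → pairColouring f l ≡ (false , b)) 2 r →
                  ∃ λ S → Descending N S × length S ≡ suc r × ¬ Meets f S (not b)
clique⇒constant {N} {f} {b} {r} 1≤r c = points (suc r) , descending , length-points , refute
  where
  open Clique c
  points : ℕ → List ℕ
  points a = map x (downFrom a)
  length-points : length (points (suc r)) ≡ suc r
  length-points = trans (length-map x (downFrom (suc r))) (length-downFrom (suc r))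
  points-desc : ∀ a → a ≤ r → Descending (x a) (points a)
  points-desc zero    _   = tt
  points-desc (suc a) a<r = proj₁ (x-≺ ≤-refl a<r) , points-desc a (<⇒≤ a<r)
  descending : Descending N (points (suc r))
  descending = proj₂ (x-≺ 1≤r ≤-refl) , points-desc r ≤-refl
  index : ∀ a {i} → mem (points a) i ≡ true → ∃ λ j → j < a × x j ≡ i
  index (suc a) {i} p with x a ≟ i
  ... | yes eq = a , ≤-refl , eq
  ... | no neq = let (j , j<a , eq) = index a (trans (cong (_∨ mem (points a) i) (sym (dec-false (x a ≟ i) neq))) p)
                 in j , m≤n⇒m≤1+n j<a , eq
  refute : ¬ Meets f (points (suc r)) (not b)
  refute (_ , _ , lt , i∈ , j∈ , neq) with index (suc r) i∈ | index (suc r) j∈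
  ... | i , i≤r , refl | j , j≤r , refl with <-cmp j i
  ...   | tri≈ _ refl _ = <-irrefl refl lt
  ...   | tri> _ _ i<j  = <-asym lt (proj₁ (x-≺ i<j (≤-pred j≤r)))
  ...   | tri< j<i _ _  = not-¬ (,-injectiveʳ (edge (j ∷ i ∷ []) (cons z≤n (≤-pred j≤r) (cons j<i (≤-pred i≤r) [])) refl)) neq

ramsey : ∀ m r → 2 * m + 4 ≤ suc r →
         ∃ λ f → ∀ b → ¬ Clique _<[ 2 ^ m ]_ (λ l → pairColouring f l ≡ (false , b)) 2 r
-- A clique with parameter `r` has `suc r` vertices.
ramsey m r big with erdős m (suc r) big
... | f , meets = f , λ b c → let (S , d , l , ¬meets) = clique⇒constant 1≤r c in ¬meets (meets S b d l)
  where
  1≤r : 1 ≤ r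
  1≤r = ≤-pred (≤-trans (s≤s (s≤s z≤n)) (≤-trans (m≤n+m 4 (2 * m)) big))

-- From graphs to copies

enumerate : ∀ {lo n k J} → Ix lo n J → length J ≡ k →
            Σ (Fin k → Fin (suc n)) λ g →
              Increasing g × (∀ i → lo ≤ toℕ (g i)) × tabulate (toℕ ∘ g) ≡ J
enumerate [] refl = (λ ()) , (λ ()) , (λ ()) , refl
enumerate {lo} {n} {suc k} (cons {j} lo≤j j≤n J-ix) J-len with enumerate J-ix (suc-injective J-len)
... | g′ , inc , above , eq = g , g-inc , g-above , cong₂ _∷_ j≡ eq
  where
  g : Fin (suc k) → Fin (suc n)
  g fzero    = fromℕ< (s≤s j≤n)
  g (fsuc i) = g′ i
  j≡ : toℕ (fromℕ< (s≤s j≤n)) ≡ j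
  j≡ = Fₚ.toℕ-fromℕ< (s≤s j≤n)
  g-inc : Increasing g
  g-inc fzero    (fsuc b) _   = subst (_< toℕ (g′ b)) (sym j≡) (above b)
  g-inc (fsuc a) (fsuc b) a<b = inc a b (≤-pred a<b)
  g-above : ∀ i → lo ≤ toℕ (g i)
  g-above fzero    = subst (lo ≤_) (sym j≡) lo≤j
  g-above (fsuc i) = ≤-trans (≤-trans lo≤j (n≤1+n j)) (above i)

-- Copies are indexed by all of ℕ; indices beyond `n` get the default `n`.
clamp : ∀ n → ℕ → Fin (suc n)
clamp n i = fromℕ< (s≤s (m⊓n≤n i n))

toℕ-clamp : ∀ {n i} → i ≤ n → toℕ (clamp n i) ≡ i
toℕ-clamp {n} {i} i≤n = trans (Fₚ.toℕ-fromℕ< (s≤s (m⊓n≤n i n))) (m≤n⇒m⊓n≡m i≤n)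

clamp-toℕ : ∀ {n} (i : Fin (suc n)) → clamp n (toℕ i) ≡ i
clamp-toℕ i = Fₚ.toℕ-injective (toℕ-clamp (≤-pred (Fₚ.toℕ<n i)))

tabulate-∷ʳ : ∀ n (f : Fin (suc n) → ℕ) → tabulate f ≡ tabulate (f ∘ inject₁) ++ [ f (fromℕ n) ]
tabulate-∷ʳ zero    f = refl
tabulate-∷ʳ (suc n) f = cong (f fzero ∷_) (tabulate-∷ʳ n (f ∘ fsuc))

tabulate-opposite : ∀ n (f : Fin n → ℕ) → tabulate (f ∘ opposite) ≡ reverse (tabulate f)
tabulate-opposite zero    f = refl
tabulate-opposite (suc n) f = begin
  f (fromℕ n) ∷ tabulate (f ∘ inject₁ ∘ opposite)       ≡⟨ cong (f (fromℕ n) ∷_) (tabulate-opposite n (f ∘ inject₁)) ⟩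
  f (fromℕ n) ∷ reverse (tabulate (f ∘ inject₁))        ≡⟨ reverse-++ (tabulate (f ∘ inject₁)) [ f (fromℕ n) ] ⟨
  reverse (tabulate (f ∘ inject₁) ++ [ f (fromℕ n) ])   ≡⟨ cong reverse (tabulate-∷ʳ n f) ⟨
  reverse (tabulate f)                                  ∎
  where open ≡-Reasoning

opposite-< : ∀ {n} {i j : Fin n} → i F.< j → opposite j F.< opposite i
opposite-< {n} {i} {j} i<j =
  subst₂ _<_ (sym (Fₚ.opposite-prop j)) (sym (Fₚ.opposite-prop i)) (∸-monoʳ-< (s≤s i<j) (Fₚ.toℕ<n j))

module _ {k n n′ : ℕ} {I : Fin k → Fin (suc n)} {F : OrdGraph (suc k)}
  (2≤n′ : 2 ≤ n′) (n′≤n : n′ ≤ n) (I≥1 : ∀ i → 1 ≤ toℕ (I i)) (I-inc : Increasing I)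
  {_≺_ : ℕ → ℕ → Set} {E : List ℕ → Set} (ψ : Fin (V F) → ℕ)
  (ψ-≺ : ∀ {a b} → a F.< b → ψ a ≺ ψ b)
  -- Edge F need not respect pointwise equality of enumerations.
  (edges : ∀ e → Increasing e → (∀ e′ → (∀ i → e′ i ≡ e i) → Edge F e′) → E (tabulate (ψ ∘ e)))
  where

  -- Only the vertices x_j with `j ≤ n′` and the edges they span are kept, so a bound for a smaller
  -- `n′` serves every larger `n`.
  member⇒copy : InFam k n I F → Copy _≺_ E k n′ (tabulate (toℕ ∘ I))
  member⇒copy (x , y , x-inc , y-between , _ , _ , are-edges) = record
    { x    = x̂
    ; x-≺  = λ i<j j≤n′ → let j≤n = ≤-trans j≤n′ n′≤n in ψ-≺ (x-inc _ _
               (subst₂ _<_ (sym (toℕ-clamp (≤-trans (<⇒≤ i<j) j≤n))) (sym (toℕ-clamp j≤n)) i<j))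
    ; edge = edge
    ; base = subst (λ l → E (x̂ 0 ∷ l)) (sym (map-x̂ I))
               (edges e₀ e₀-inc (λ e′ eq → are-edges e′ (inj₂ (eq fzero , eq ∘ fsuc))))
    }
    where
    x̂ : ℕ → ℕ
    x̂ i = ψ (x (clamp n i))
    map-x̂ : (J : Fin k → Fin (suc n)) → map x̂ (tabulate (toℕ ∘ J)) ≡ tabulate (ψ ∘ x ∘ J)
    map-x̂ J = trans (map-tabulate (toℕ ∘ J) x̂) (tabulate-cong (cong (ψ ∘ x) ∘ clamp-toℕ ∘ J))
    1≤n : 1 ≤ n
    1≤n = ≤-trans (<⇒≤ 2≤n′) n′≤n
    ≼ : ∀ {a b} → toℕ a ≤ toℕ b → ψ a ≡ ψ b ⊎ ψ a ≺ ψ b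
    ≼ a≤b with m≤n⇒m<n∨m≡n a≤b
    ... | inj₁ a<b = inj₂ (ψ-≺ a<b)
    ... | inj₂ a≡b = inj₁ (cong ψ (Fₚ.toℕ-injective a≡b))
    prepend : Fin (V F) → (Fin k → Fin (suc n)) → Fin (suc k) → Fin (V F)
    prepend v J fzero    = v
    prepend v J (fsuc i) = x (J i)
    prepend-inc : ∀ {v J} → Increasing J → (∀ i → v F.< x (J i)) → Increasing (prepend v J)
    prepend-inc J-inc v< fzero    (fsuc j) _   = v< j
    prepend-inc J-inc v< (fsuc i) (fsuc j) i<j = x-inc _ _ (J-inc i j (≤-pred i<j))
    e₀ : Fin (suc k) → Fin (V F)
    e₀ = prepend (x fzero) I
    e₀-inc : Increasing e₀
    e₀-inc = prepend-inc I-inc (λ i → x-inc _ _ (I≥1 i))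
    edge : ∀ J → Ix 2 n′ J → length J ≡ k →
           ∃ λ z → (x̂ 0 ≡ z ⊎ x̂ 0 ≺ z) × (z ≡ x̂ 1 ⊎ z ≺ x̂ 1) × E (z ∷ map x̂ J)
    edge J J-ix J-len with enumerate (Ix-weaken ≤-refl n′≤n J-ix) J-len
    ... | g , g-inc , g≥2 , refl =
      ψ (y g) , ≼ (proj₁ (y-between g isJ)) , ≼ y≤x₁ ,
      subst (λ l → E (ψ (y g) ∷ l)) (sym (map-x̂ g))
        (edges (prepend (y g) g) (prepend-inc g-inc y<)
          (λ e′ eq → are-edges e′ (inj₁ (g , isJ , eq fzero , eq ∘ fsuc))))
      where
      isJ : IsJ k n g
      isJ = g-inc , g≥2
      y≤x₁ : toℕ (y g) ≤ toℕ (x (clamp n 1))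
      y≤x₁ = proj₂ (y-between g isJ) (clamp n 1) (toℕ-clamp 1≤n)
      y< : ∀ i → y g F.< x (g i)
      y< i = ≤-<-trans y≤x₁ (x-inc _ _ (subst (_< toℕ (g i)) (sym (toℕ-clamp 1≤n)) (g≥2 i)))

-- The four colours and monochromatic copies

encode : Colour → Fin 4
encode (false , false) = fzero
encode (false , true)  = fsuc fzero
encode (true , false)  = fsuc (fsuc fzero)
encode (true , true)   = fsuc (fsuc (fsuc fzero))

decode : Fin 4 → Colour
decode fzero                      = false , false
decode (fsuc fzero)               = false , true
decode (fsuc (fsuc fzero))        = true , false
decode (fsuc (fsuc (fsuc fzero))) = true , true

decode-encode : ∀ c → decode (encode c) ≡ c
decode-encode (false , false) = refl
decode-encode (false , true)  = refl
decode-encode (true , false)  = refl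
decode-encode (true , true)   = refl

listColouring : ∀ k M → (List ℕ → Colour) → Coloring (suc k) M 4
listColouring k M χ e = encode (χ (tabulate (toℕ ∘ e)))

module _ {k n n′ M : ℕ} {I : Fin k → Fin (suc n)} {G : OrdGraph (suc k)}
  (2≤n′ : 2 ≤ n′) (n′≤n : n′ ≤ n) (I≥1 : ∀ i → 1 ≤ toℕ (I i)) (I-inc : Increasing I)
  (χ : List ℕ → Colour)
  (no-copy : ∀ b → ¬ Copy _<[ M ]_ (λ l → χ l ≡ (false , b)) k n′ (tabulate (toℕ ∘ I)))
  (no-rev  : ∀ b → ¬ Copy (flip _<[ M ]_) (λ l → χ (reverse l) ≡ (true , b)) k n′ (tabulate (toℕ ∘ I)))
  where

  -- The side of the colour selects which of the two members inside `G` is contradicted; the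
  -- reversed one is read backwards, as a copy for the flipped order.
  no-mono : InFStar k n I G → ¬ MonoCopy (listColouring k M χ) G
  no-mono member (φ , φ-inc , α , mono) with decode α in eq
  no-mono ((F , F∈ , θ , θ-inc , θ-edge) , _) (φ , φ-inc , α , mono) | false , b =
    no-copy b (member⇒copy 2≤n′ n′≤n I≥1 I-inc (toℕ ∘ φ ∘ θ)
      (λ {_} {c} a<c → φ-inc _ _ (θ-inc _ _ a<c) , Fₚ.toℕ<n (φ (θ c)))
      (λ e e-inc e∈ → trans (sym (decode-encode _)) (trans
        (cong decode (mono (θ ∘ e) (λ i j i<j → θ-inc _ _ (e-inc i j i<j)) (θ-edge e e-inc (e∈ e (λ _ → refl))))) eq)) F∈)
  no-mono (_ , (F , F∈ , θ , θ-inc , θ-edge)) (φ , φ-inc , α , mono) | true , b =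
    no-rev b (member⇒copy 2≤n′ n′≤n I≥1 I-inc ψ
      (λ {a} a<c → φ-inc _ _ (θ-inc _ _ (opposite-< a<c)) , Fₚ.toℕ<n (φ (θ (opposite a))))
      (λ e e-inc e∈ → trans (cong χ (sym (tabulate-opposite (suc k) (ψ ∘ e))))
        (trans (sym (decode-encode _)) (trans
        (cong decode (mono (θ ∘ flipped e) (λ i j i<j → θ-inc _ _ (flipped-inc e e-inc i j i<j))
          (θ-edge (flipped e) (flipped-inc e e-inc)
            -- Reversing twice returns `e` only pointwise.
            (e∈ _ (λ i → trans (Fₚ.opposite-involutive _) (cong e (Fₚ.opposite-involutive i))))))) eq))) F∈)
    where
    ψ : Fin (V F) → ℕ
    ψ v = toℕ (φ (θ (opposite v)))
    flipped : (Fin (suc k) → Fin (V F)) → Fin (suc k) → Fin (V F)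
    flipped e i = opposite (e (opposite i))
    flipped-inc : ∀ e → Increasing e → Increasing (flipped e)
    flipped-inc e e-inc i j i<j = opposite-< (e-inc _ _ (opposite-< i<j))

-- Iteration

module Stages (r : ℕ) (1≤r : 1 ≤ r) where

  -- Each value is `suc n + r * n` from the step that produces it: first with `n = 1`, later with
  -- `size j` for both `n` and the clique bound.
  size : ℕ → ℕ
  size zero    = suc (suc r)
  size (suc j) = suc (size j) + size j * size j

  -- The index set without its fixed elements 1 and 2.
  index : ℕ → List ℕ
  index zero    = []
  index (suc j) = index j ++ [ suc (size j) ]

  j+3≤size : ∀ j → j + 3 ≤ size j
  j+3≤size zero    = s≤s (s≤s 1≤r)
  j+3≤size (suc j) = ≤-trans (s≤s (j+3≤size j)) (m≤m+n (suc (size j)) _)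

  3≤size : ∀ j → 3 ≤ size j
  3≤size j = ≤-trans (m≤n+m 3 j) (j+3≤size j)

  index-ix : ∀ j → Ix 3 (size j) (index j)
  index-ix zero    = []
  index-ix (suc j) = Ix-weaken ≤-refl (m≤m+n (suc (size j)) _)
    (Ix-snoc ≤-refl (m≤n⇒m≤1+n (3≤size j)) (index-ix j))

  index₂-ix : ∀ j → Ix 2 (size j) (2 ∷ index j)
  index₂-ix j = cons ≤-refl (<⇒≤ (3≤size j)) (index-ix j)

  index₁-ix : ∀ j → Ix 1 (size j) (1 ∷ 2 ∷ index j)
  index₁-ix j = cons ≤-refl (≤-trans (s≤s z≤n) (3≤size j)) (index₂-ix j)

  length-index : ∀ j → length (index j) ≡ j
  length-index zero    = refl
  length-index (suc j) = trans (length-++ (index j)) (trans (cong (_+ 1) (length-index j)) (+-comm j 1))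

  -- With 1 added, each value is at most the square of the one before.
  size-bound : ∀ j → suc (size j) ≤ (3 + r) ^ (2 ^ j)
  size-bound zero    = ≤-reflexive (sym (*-identityʳ (3 + r)))
  size-bound (suc j) = begin
    suc (suc n + n * n)            ≤⟨ s≤s (s≤s (+-monoˡ-≤ (n * n) (m≤n+m n (n ∸ 1)))) ⟩
    suc (suc (n ∸ 1 + n + n * n))  ≡⟨ cong (λ a → suc (a + n + n * n)) (m+[n∸m]≡n (≤-trans (s≤s z≤n) (3≤size j))) ⟩
    suc (n + n + n * n)            ≡⟨ solve 1 (λ n → con 1 :+ (n :+ n :+ n :* n) := (con 1 :+ n) :* (con 1 :+ n)) refl n ⟩
    suc n * suc n                  ≤⟨ *-mono-≤ (size-bound j) (size-bound j) ⟩
    (3 + r) ^ (2 ^ j) * (3 + r) ^ (2 ^ j) ≡⟨ ^-distribˡ-+-* (3 + r) (2 ^ j) (2 ^ j) ⟨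
    (3 + r) ^ (2 ^ j + 2 ^ j)      ≡⟨ cong (λ a → (3 + r) ^ (2 ^ j + a)) (+-identityʳ (2 ^ j)) ⟨
    (3 + r) ^ (2 ^ suc j)          ∎
    where
    open ≤-Reasoning
    open +-*-Solver
    n = size j

  Stage : ℕ → ℕ → (List ℕ → Colour) → Set
  Stage m j χ =
      (∀ b → ¬ Copy _<[ t (2 + j) m ]_ (λ l → χ l ≡ (false , b)) (2 + j) (size j) (1 ∷ 2 ∷ index j))
    × (∀ b → ¬ Copy (flip _<[ t (2 + j) m ]_) (λ l → χ (reverse l) ≡ (true , b)) (2 + j) (size j) (1 ∷ 2 ∷ index j))

  stage-zero : ∀ m f → (∀ b → ¬ Clique _<[ t 1 m ]_ (λ l → pairColouring f l ≡ (false , b)) 2 r) →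
               Stage m 0 (stepUp (t 1 m) (pairColouring f))
  stage-zero m f no-clique =
    stepUp-copy {N = t 1 m} no-clique no-copy ≤-refl [] refl (inj₁ (refl , refl)) n′-big ,
    stepUp-rev {N = t 1 m} no-clique no-copy ≤-refl [] refl (inj₁ (refl , refl)) n′-big
    where
    side : ∀ l → proj₁ (pairColouring f l) ≡ false
    side []              = refl
    side (_ ∷ [])        = refl
    side (_ ∷ _ ∷ [])    = refl
    side (_ ∷ _ ∷ _ ∷ _) = refl
    no-copy : ∀ b → ¬ Copy (flip _<[ t 1 m ]_) (λ l → pairColouring f (reverse l) ≡ (true , b)) 1 1 (1 ∷ [])
    no-copy b c = contradiction
      (trans (sym (cong proj₁ (Copy.base c))) (side (reverse (Copy.x c 0 ∷ Copy.x c 1 ∷ [])))) λ ()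
    n′-big : 2 + r * 1 ≤ size 0
    n′-big = ≤-reflexive (cong (2 +_) (*-identityʳ r))

  stage-suc : ∀ m j χ → Stage m j χ → Stage m (suc j) (stepUp (t (2 + j) m) χ)
  stage-suc m j χ (no-copy , no-rev) =
    stepUp-copy {N = t (2 + j) m} no-clique no-rev 1≤n (index₂-ix j) len head ≤-refl ,
    stepUp-rev {N = t (2 + j) m} no-clique no-rev 1≤n (index₂-ix j) len head ≤-refl
    where
    1≤n : 1 ≤ size j
    1≤n = ≤-trans (s≤s z≤n) (3≤size j)
    len : length (2 ∷ index j) ≡ suc j
    len = cong suc (length-index j)
    head : (size j ≡ 1 × 2 ∷ index j ≡ []) ⊎ (3 + j ≤ size j × ∃ λ I′ → 2 ∷ index j ≡ 2 ∷ I′)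
    head = inj₂ (subst (_≤ size j) (+-comm j 3) (j+3≤size j) , index j , refl)
    no-clique : ∀ b → ¬ Clique _<[ t (2 + j) m ]_ (λ l → χ l ≡ (false , b)) (3 + j) (size j)
    no-clique b c = no-copy b (clique⇒copy 1≤n (index₁-ix j) (cong suc len) c)

  stage : ∀ m → 2 * m + 4 ≤ suc r → ∀ j → ∃ (Stage m j)
  stage m r-big zero    = let (f , no-clique) = ramsey m r r-big in _ , stage-zero m f no-clique
  stage m r-big (suc j) = let (χ , good) = stage m r-big j in _ , stage-suc m j χ good

-- Choice of the parameters

root : ∀ Q → 1 ≤ Q → ∀ n → ∃ λ s → s ^ Q ≤ n × n < suc s ^ Q
root (suc Q) _ zero    = 0 , z≤n , m^n>0 1 (suc Q)
root (suc Q) p (suc n) with root (suc Q) p n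
... | s , s≤ , <s with suc n <? suc s ^ suc Q
...   | yes lt = s , m≤n⇒m≤1+n s≤ , lt
...   | no  ≮  = suc s , ≮⇒≥ ≮ , ≤-<-trans <s (^-monoˡ-< (suc Q) ≤-refl)

^-reflects-< : ∀ Q {a b} → a ^ Q < b ^ Q → a < b
^-reflects-< Q {a} {b} p = ≰⇒> (λ b≤a → <⇒≱ p (^-monoˡ-≤ Q b≤a))

-- From `m = 4` on, 6 ≤ 2m and 4m ≤ m²; for smaller `m` the bound 12 = 2 · 3 + 6 suffices.
2m+6≤s : ∀ m s → 12 ≤ s → m * m ≤ s → 2 * m + 6 ≤ s
2m+6≤s m s 12≤s mm≤s with m ≤? 3
... | yes m≤3 = ≤-trans (+-monoˡ-≤ 6 (*-monoʳ-≤ 2 m≤3)) 12≤s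
... | no  m≰3 = begin
  2 * m + 6       ≤⟨ +-monoʳ-≤ (2 * m) (≤-trans (m≤n+m 6 2) (*-monoʳ-≤ 2 (≰⇒> m≰3))) ⟩
  2 * m + 2 * m   ≡⟨ *-distribʳ-+ m 2 2 ⟨
  4 * m           ≤⟨ *-monoˡ-≤ m (≰⇒> m≰3) ⟩
  m * m           ≤⟨ mm≤s ⟩
  s               ∎
  where open ≤-Reasoning

theorem2p3 : (k1 : ℕ) → 2 ≤ k1 →
    Σ ℕ λ p → Σ ℕ λ q → 0 < p × 0 < q × Σ ℕ λ n0 →
    (n : ℕ) → n0 ≤ n →
    Σ (Fin k1 → Fin (suc n)) λ I → IsI k1 n I ×
    ((G : OrdGraph (suc k1)) → InFStar k1 n I G →
    (m : ℕ) → m ^ q ≤ n ^ p →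
    Σ (Coloring (suc k1) (t k1 m) 4) λ χ → ¬ MonoCopy χ G)
theorem2p3 (suc (suc j)) (s≤s (s≤s z≤n)) =
  -- The exponent is 1 / (2Q): the Q-th root undoes the `j` squarings in `size`, and the factor 2
  -- gives `m * m ≤ s`. The threshold makes the root at least 12.
  1 , 2 * Q , s≤s z≤n , ≤-trans 1≤Q (m≤m+n Q _) , 12 ^ Q , main
  where
  Q = 2 ^ j
  1≤Q : 1 ≤ Q
  1≤Q = m^n>0 2 j
  main : (n : ℕ) → 12 ^ Q ≤ n →
    Σ (Fin (2 + j) → Fin (suc n)) λ I → IsI (2 + j) n I ×
    ((G : OrdGraph (3 + j)) → InFStar (2 + j) n I G →
    (m : ℕ) → m ^ (2 * Q) ≤ n ^ 1 →
    Σ (Coloring (3 + j) (t (2 + j) m) 4) λ χ → ¬ MonoCopy χ G)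
  -- With `s` the integer part of the Q-th root and `r = s - 3`, `size j` is below `s ^ Q` and so
  -- below `n`. Thus `r` and `I` depend on `n` but not on `m`.
  main n n-big with root Q 1≤Q n
  ... | s , s≤ , <s with ≤-pred (^-reflects-< Q (≤-<-trans n-big <s))
  ... | 12≤s with m≤n⇒∃[o]m+o≡n {3} (≤-trans (m≤m+n 3 9) 12≤s)
  ... | r , refl = I , (I-inc , I≥1 , fzero , ∷-injectiveˡ I-list) , avoid
    where
    open Stages r (≤-trans (s≤s z≤n) (≤-pred (≤-pred (≤-pred 12≤s))))
    size≤n : size j ≤ n
    size≤n = ≤-trans (<⇒≤ (size-bound j)) s≤
    I-enum = enumerate (Ix-weaken ≤-refl size≤n (index₁-ix j)) (cong (suc ∘ suc) (length-index j))
    I = proj₁ I-enum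
    I-inc = proj₁ (proj₂ I-enum)
    I≥1 = proj₁ (proj₂ (proj₂ I-enum))
    I-list : tabulate (toℕ ∘ I) ≡ 1 ∷ 2 ∷ index j
    I-list = proj₂ (proj₂ (proj₂ I-enum))
    avoid : (G : OrdGraph (3 + j)) → InFStar (2 + j) n I G → (m : ℕ) → m ^ (2 * Q) ≤ n ^ 1 →
            Σ (Coloring (3 + j) (t (2 + j) m) 4) λ χ → ¬ MonoCopy χ G
    avoid G member m m-small = conclude (stage m r-big j)
      where
      mm≤s : m * m ≤ 3 + r
      mm≤s = ≤-pred (^-reflects-< Q (begin-strict
        (m * m) ^ Q     ≡⟨ cong (λ a → (m * a) ^ Q) (*-identityʳ m) ⟨
        (m ^ 2) ^ Q     ≡⟨ ^-*-assoc m 2 Q ⟩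
        m ^ (2 * Q)     ≤⟨ m-small ⟩
        n * 1           ≡⟨ *-identityʳ n ⟩
        n               <⟨ <s ⟩
        (4 + r) ^ Q     ∎))
        where open ≤-Reasoning
      r-big : 2 * m + 4 ≤ suc r
      r-big = +-cancelˡ-≤ 2 _ _ (begin
        2 + (2 * m + 4)   ≡⟨ +-comm 2 (2 * m + 4) ⟩
        2 * m + 4 + 2     ≡⟨ +-assoc (2 * m) 4 2 ⟩
        2 * m + 6         ≤⟨ 2m+6≤s m (3 + r) 12≤s mm≤s ⟩
        3 + r             ∎)
        where open ≤-Reasoning
      conclude : ∃ (Stage m j) → Σ (Coloring (3 + j) (t (2 + j) m) 4) λ χ → ¬ MonoCopy χ G
      conclude (χ , no-copy , no-rev) = listColouring (2 + j) (t (2 + j) m) χ ,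
        no-mono {G = G} (<⇒≤ (3≤size j)) size≤n I≥1 I-inc χ
          (λ b c → no-copy b (subst (Copy _ _ _ _) I-list c))
          (λ b c → no-rev b (subst (Copy _ _ _ _) I-list c)) member
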